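{- Let $n$ and $m$ be positive integers, let $\zeta$ be a primitive $m$th root of unity, and write $n=mk+i$ with $0\le i<m$. Then $$A_n(\zeta,r) = A_i(\zeta,r)\,\frac{(r)_n}{(r)_i\,(1-r^m)^k}.$$
   Context: For $n\ge 0$, $A_n(t,r):=\sum_{\pi\in S_n} t^{\ell(\pi)} r^{{\rm maj}(\pi)}$, where $S_n$ is the symmetric group on $\{1,\dots,n\}$ (so $A_0=1$), $\ell(\pi)$ is the number of inversions of $\pi$ (its Coxeter length with respect to adjacent transpositions), and ${\rm maj}(\pi)=\sum\{\,j: \pi(j)>\pi(j+1)\,\}$ is the major index. $(r)_n:=(1-r)(1-r^2)\cdots(1-r^n)$, $(r)_0=1$. -}

module Defs where

open import Level using (Level)
open import Data.Nat as ℕ using (ℕ; zero; suc)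
open import Data.Fin as Fin using (Fin; toℕ)
open import Data.Fin.Properties using (_≟_)
open import Data.List using (List; []; _∷_; _++_; map; concatMap; filter; foldr; allFin)
open import Data.Bool using (Bool; true; false; _∧_; _∨_; not; T)
open import Data.Product using (_×_)
open import Data.Sum using (_⊎_)
open import Relation.Nullary using (¬_)
open import Relation.Nullary.Decidable using (⌊_⌋)
open import Algebra.Bundles using (CommutativeRing)

-- Permutations of {1,…,n} are represented (in one-line notation,
-- 0-indexed) as functions π : Fin n → Fin n that are injective
-- (equivalently bijective, since Fin n is finite).

consF : {n k : ℕ} → Fin k → (Fin n → Fin k) → Fin (suc n) → Fin k
consF a f Fin.zero    = a
consF a f (Fin.suc i) = f i

allFuns : (n k : ℕ) → List (Fin n → Fin k)
allFuns zero    k = (λ ()) ∷ []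
allFuns (suc n) k =
  concatMap (λ (a : Fin k) → map (λ (f : Fin n → Fin k) → consF a f) (allFuns n k))
            (allFin k)

allB : (n : ℕ) → (Fin n → Bool) → Bool
allB n p = foldr (λ i b → p i ∧ b) true (allFin n)

isInjectiveB : {n : ℕ} → (Fin n → Fin n) → Bool
isInjectiveB {n} π = allB n λ i → allB n λ j → ⌊ i ≟ j ⌋ ∨ not ⌊ π i ≟ π j ⌋

Sym : (n : ℕ) → List (Fin n → Fin n)
Sym n = filter (λ π → Data.Bool.T? (isInjectiveB π)) (allFuns n n)
  where import Data.Bool

countB : (n : ℕ) → (Fin n → Bool) → ℕ
countB n p = foldr (λ i c → (if p i then suc c else c)) 0 (allFin n)
  where open import Data.Bool using (if_then_else_)

sumFin : (n : ℕ) → (Fin n → ℕ) → ℕ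
sumFin n f = foldr (λ i s → f i ℕ.+ s) 0 (allFin n)

inv : {n : ℕ} → (Fin n → Fin n) → ℕ
inv {n} π = sumFin n λ i → countB n λ j → ⌊ i Fin.<? j ⌋ ∧ ⌊ π j Fin.<? π i ⌋

-- maj(π) = Σ { j : π(j) > π(j+1) } with positions 1-indexed:
-- 0-indexed position i (with i+1 < n) is a descent at position toℕ i + 1.
maj : {n : ℕ} → (Fin n → Fin n) → ℕ
maj {zero}  π = 0
maj {suc n} π =
  sumFin n λ (i : Fin n) →
    (if ⌊ π (Fin.suc i) Fin.<? π (Fin.inject₁ i) ⌋ then suc (toℕ i) else 0)
  where open import Data.Bool using (if_then_else_)

module _ {c ℓ : Level} (R : CommutativeRing c ℓ) where
  open CommutativeRing R

  pow : Carrier → ℕ → Carrier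
  pow x zero    = 1#
  pow x (suc k) = x * pow x k

  IsIntegralDomain : Set (c Level.⊔ ℓ)
  IsIntegralDomain = (¬ (1# ≈ 0#)) × (∀ a b → a * b ≈ 0# → (a ≈ 0#) ⊎ (b ≈ 0#))

  IsPrimitiveRoot : ℕ → Carrier → Set ℓ
  IsPrimitiveRoot m ζ = (pow ζ m ≈ 1#) × (∀ j → 0 ℕ.< j → j ℕ.< m → ¬ (pow ζ j ≈ 1#))

  A : ℕ → Carrier → Carrier → Carrier
  A n t r = foldr (λ π s → (pow t (inv π) * pow r (maj π)) + s) 0# (Sym n)

  qPoch : Carrier → ℕ → Carrier
  qPoch r zero    = 1#
  qPoch r (suc n) = qPoch r n * (1# - pow r (suc n))

{-# OPTIONS --safe #-}
module Submission where

-- Let [n,j] be the t-binomial coefficient and (r)ₙ = (1-r)⋯(1-rⁿ).  Appending letters one at a time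
-- and sorting permutations by their last descent gives, for n ≥ 1,
--   Aₙ(t,r) = Σ_{j<n} [n,j] rʲ Aⱼ (r)ₙ₋₁/(r)ⱼ.
-- At a primitive m-th root of unity, [m,j] = 0 for 0 < j < m, so the operator L_n f = Σ_j [n,j] f(j)
-- satisfies L_{n+m} f = L_n f + L_n (f(m + ·)) (q-Lucas).  By strong induction on n = mk+i, the
-- recurrence multiplied by (r)ᵢ (1-rᵐ)ᵏ factors as (r)ₙ₋₁ Aᵢ times the binomial expansion of
-- (rᵐ + (1-rᵐ))ᵏ = 1, short of the term j = n, which is rⁿ (r)ₙ₋₁ Aᵢ; what remains is (r)ₙ Aᵢ.
-- No division by 1-rʲ occurs, so r itself may be a root of unity.

open import Defs
open import Level using (Level)
open import Algebra.Bundles using (CommutativeRing)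
open import Algebra.Properties.CommutativeMonoid.Sum as Sum using ()
open import Data.Bool using (Bool; true; false; _∧_; _∨_; not; if_then_else_; T; T?)
open import Data.Empty using (⊥-elim)
open import Data.Fin as Fin using (Fin; toℕ; inject₁; fromℕ; punchIn)
open import Data.Fin.Properties using (_≟_; toℕ-inject₁; toℕ-fromℕ; toℕ<n; punchInᵢ≢i; punchIn-injective; fromℕ≢inject₁; inject₁-injective)
open import Data.Fin.Relation.Unary.Top using (view; ‵fromℕ; ‵inject₁)
open import Data.List as List using (List; []; _∷_; _++_; concatMap; filter; tabulate)
open import Data.Nat as ℕ using (ℕ; zero; suc; s≤s; z<s; s<s; _∸_; _<ᵇ_)
open import Data.Nat.Induction using (<-rec)
import Data.Nat.Properties as ℕₚ
open import Data.Product using (_×_; _,_; proj₁; proj₂)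
open import Data.Sum using (inj₁; inj₂)
open import Data.Unit using (tt)
import Data.Vec.Functional as Vector
open import Function using (_∘_)
open import Relation.Binary.PropositionalEquality as ≡ using (_≡_; _≗_)
open import Relation.Nullary using (¬_; yes; no)
open import Relation.Nullary.Decidable using (⌊_⌋; isYes≗does)

-- The quotient (r)ₙ₋₁/(r)ⱼ in the recurrence comes from rewriting the weights. At position s an
-- ascent weighs 1 and a descent rˢ; equivalently, rˢ is paid for either comparison and a further
-- 1-rˢ for an ascent. Let j be the last position where the first option is taken, or 0 if there is
-- none. The first j letters are then unrestricted and give Aⱼ, the remaining letters increase and
-- give the product of 1-rˢ for j < s < n, and [n,j] records the inversions that involve this final
-- run. The induction has to avoid a circle: the full binomial sum contains a term j = n, where the
-- claim is still open. The predicted value is put there instead, added to both sides, and cancelled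
-- in the additive group.

private module ∑ℕ = Sum ℕₚ.+-0-commutativeMonoid

private variable
  n k : ℕ

snoc : {A : Set} → (Fin n → A) → A → Fin (suc n) → A
snoc {zero}  g a _            = a
snoc {suc n} g a Fin.zero     = g Fin.zero
snoc {suc n} g a (Fin.suc i)  = snoc (g ∘ Fin.suc) a i

snoc-inject₁ : {A : Set} (g : Fin n → A) (a : A) (i : Fin n) → snoc g a (inject₁ i) ≡ g i
snoc-inject₁ g a Fin.zero    = ≡.refl
snoc-inject₁ g a (Fin.suc i) = snoc-inject₁ (g ∘ Fin.suc) a i

snoc-fromℕ : ∀ {n} {A : Set} (g : Fin n → A) (a : A) → snoc g a (fromℕ n) ≡ a
snoc-fromℕ {zero}  g a = ≡.refl
snoc-fromℕ {suc n} g a = snoc-fromℕ (g ∘ Fin.suc) a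

snoc-cong : {A : Set} {g h : Fin n → A} (a : A) → g ≗ h → snoc g a ≗ snoc h a
snoc-cong {zero}  a eq i           = ≡.refl
snoc-cong {suc n} a eq Fin.zero    = eq Fin.zero
snoc-cong {suc n} a eq (Fin.suc i) = snoc-cong a (eq ∘ Fin.suc) i

foldr-tabulate : {X B C : Set} (g : X → B) (_•_ : B → C → C) (e : C) (h : Fin n → X) →
  List.foldr (λ x s → g x • s) e (tabulate h) ≡ Vector.foldr _•_ e (g ∘ h)
foldr-tabulate {zero}  g _•_ e h = ≡.refl
foldr-tabulate {suc n} g _•_ e h = ≡.cong (g (h Fin.zero) •_) (foldr-tabulate g _•_ e (h ∘ Fin.suc))

𝟙 : Bool → ℕ
𝟙 b = if b then 1 else 0

sumFin≡sum : (f : Fin n → ℕ) → sumFin n f ≡ ∑ℕ.sum f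
sumFin≡sum f = foldr-tabulate f ℕ._+_ 0 (λ i → i)

countB≡sum : ∀ {n} (p : Fin n → Bool) → countB n p ≡ ∑ℕ.sum (𝟙 ∘ p)
countB≡sum p = ≡.trans (foldr-tabulate p (λ b c → if b then suc c else c) 0 (λ i → i)) (go p)
  where
  go : ∀ {n} (p : Fin n → Bool) → Vector.foldr (λ b c → if b then suc c else c) 0 p ≡ ∑ℕ.sum (𝟙 ∘ p)
  go {zero}  p = ≡.refl
  go {suc n} p with p Fin.zero
  ... | true  = ≡.cong suc (go (p ∘ Fin.suc))
  ... | false = go (p ∘ Fin.suc)

T-ext : ∀ {a b} → (T a → T b) → (T b → T a) → a ≡ b
T-ext {true}  {true}  f g = ≡.refl
T-ext {true}  {false} f g = ⊥-elim (f tt)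
T-ext {false} {true}  f g = ⊥-elim (g tt)
T-ext {false} {false} f g = ≡.refl

T-∧⁺ : ∀ {a b} → T a → T b → T (a ∧ b)
T-∧⁺ {true} _ q = q

T-∧⁻ : ∀ {a b} → T (a ∧ b) → T a × T b
T-∧⁻ {true} q = tt , q

all : (Fin n → Bool) → Bool
all = Vector.foldr _∧_ true

T-all⁺ : (p : Fin n → Bool) → (∀ i → T (p i)) → T (all p)
T-all⁺ {zero}  p ps = tt
T-all⁺ {suc n} p ps = T-∧⁺ {p Fin.zero} (ps Fin.zero) (T-all⁺ (p ∘ Fin.suc) (ps ∘ Fin.suc))

T-all⁻ : (p : Fin n → Bool) → T (all p) → ∀ i → T (p i)
T-all⁻ {suc n} p ts Fin.zero    = proj₁ (T-∧⁻ {p Fin.zero} ts)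
T-all⁻ {suc n} p ts (Fin.suc i) = T-all⁻ (p ∘ Fin.suc) (proj₂ (T-∧⁻ {p Fin.zero} ts)) i

all-cong : {p p′ : Fin n → Bool} → p ≗ p′ → all p ≡ all p′
all-cong {zero}  eq = ≡.refl
all-cong {suc n} eq = ≡.cong₂ _∧_ (eq Fin.zero) (all-cong (eq ∘ Fin.suc))

allB≡all : (p : Fin n → Bool) → allB n p ≡ all p
allB≡all p = foldr-tabulate p _∧_ true (λ i → i)

-- Injectivity of words

Inj : (Fin n → Fin k) → Set
Inj g = ∀ i j → g i ≡ g j → i ≡ j

injective : (Fin n → Fin k) → Bool
injective g = all λ i → all λ j → ⌊ i ≟ j ⌋ ∨ not ⌊ g i ≟ g j ⌋

isInjectiveB≡injective : (π : Fin n → Fin n) → isInjectiveB π ≡ injective π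
isInjectiveB≡injective {n} π = ≡.trans (allB≡all (λ i → allB n λ j → ⌊ i ≟ j ⌋ ∨ not ⌊ π i ≟ π j ⌋)) (all-cong λ i → allB≡all (λ j → ⌊ i ≟ j ⌋ ∨ not ⌊ π i ≟ π j ⌋))

injective⁺ : (g : Fin n → Fin k) → Inj g → T (injective g)
injective⁺ g inj = T-all⁺ _ λ i → T-all⁺ _ λ j → go i j
  where
  go : ∀ i j → T (⌊ i ≟ j ⌋ ∨ not ⌊ g i ≟ g j ⌋)
  go i j with i ≟ j | g i ≟ g j
  ... | yes _  | _      = tt
  ... | no i≢j | yes eq = ⊥-elim (i≢j (inj i j eq))
  ... | no _   | no _   = tt

injective⁻ : (g : Fin n → Fin k) → T (injective g) → Inj g
injective⁻ g ts i j eq with i ≟ j | g i ≟ g j | T-all⁻ _ (T-all⁻ _ ts i) j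
... | yes i≡j | _     | _ = i≡j
... | no _    | no ne | _ = ⊥-elim (ne eq)

injective-cong : {g h : Fin n → Fin k} → g ≗ h → injective g ≡ injective h
injective-cong eq = all-cong λ i → all-cong λ j → ≡.cong₂ (λ x y → ⌊ i ≟ j ⌋ ∨ not ⌊ x ≟ y ⌋) (eq i) (eq j)

injective-punchIn : (a : Fin (suc k)) (σ : Fin n → Fin k) → injective (punchIn a ∘ σ) ≡ injective σ
injective-punchIn a σ = T-ext
  (λ ts → injective⁺ σ λ i j eq → injective⁻ (punchIn a ∘ σ) ts i j (≡.cong (punchIn a) eq))
  (λ ts → injective⁺ (punchIn a ∘ σ) λ i j eq → injective⁻ σ ts i j (punchIn-injective a (σ i) (σ j) eq))

avoids : Fin k → (Fin n → Fin k) → Bool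
avoids a g = all λ i → not ⌊ g i ≟ a ⌋

avoids⁺ : (a : Fin k) (g : Fin n → Fin k) → (∀ i → ¬ g i ≡ a) → T (avoids a g)
avoids⁺ a g ne = T-all⁺ _ go
  where
  go : ∀ i → T (not ⌊ g i ≟ a ⌋)
  go i with g i ≟ a
  ... | yes eq = ⊥-elim (ne i eq)
  ... | no _   = tt

avoids⁻ : (a : Fin k) (g : Fin n → Fin k) → T (avoids a g) → ∀ i → ¬ g i ≡ a
avoids⁻ a g ts i eq with g i ≟ a | T-all⁻ _ ts i
... | no ne | _ = ne eq

injective-snoc : (g : Fin n → Fin k) (a : Fin k) → injective (snoc g a) ≡ avoids a g ∧ injective g
injective-snoc {n} g a = T-ext to from
  where
  to : T (injective (snoc g a)) → T (avoids a g ∧ injective g)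
  to ts = T-∧⁺ {avoids a g}
    (avoids⁺ a g λ i gi≡a → fromℕ≢inject₁ (inj (fromℕ n) (inject₁ i)
      (≡.trans (snoc-fromℕ g a) (≡.trans (≡.sym gi≡a) (≡.sym (snoc-inject₁ g a i))))))
    (injective⁺ g λ i j eq → inject₁-injective (inj (inject₁ i) (inject₁ j)
      (≡.trans (snoc-inject₁ g a i) (≡.trans eq (≡.sym (snoc-inject₁ g a j))))))
    where
    inj = injective⁻ (snoc g a) ts
  from : T (avoids a g ∧ injective g) → T (injective (snoc g a))
  from ts = injective⁺ (snoc g a) go
    where
    av  = avoids⁻ a g (proj₁ (T-∧⁻ {avoids a g} ts))
    inj = injective⁻ g (proj₂ (T-∧⁻ {avoids a g} ts))
    go : Inj (snoc g a)
    go i j eq with view i | view j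
    ... | ‵fromℕ     | ‵fromℕ     = ≡.refl
    ... | ‵fromℕ     | ‵inject₁ j = ⊥-elim (av j (≡.trans (≡.sym (snoc-inject₁ g a j)) (≡.trans (≡.sym eq) (snoc-fromℕ g a))))
    ... | ‵inject₁ i | ‵fromℕ     = ⊥-elim (av i (≡.trans (≡.sym (snoc-inject₁ g a i)) (≡.trans eq (snoc-fromℕ g a))))
    ... | ‵inject₁ i | ‵inject₁ j = ≡.cong inject₁ (inj i j (≡.trans (≡.sym (snoc-inject₁ g a i)) (≡.trans eq (snoc-inject₁ g a j))))

-- Inversions under appending and renumbering

-- Length and alphabet are decoupled so that a proper prefix of a permutation also has inversions,
-- and `_<ᵇ_` makes the comparisons compute.
inversions : (Fin n → Fin k) → ℕ
inversions g = ∑ℕ.sum λ i → ∑ℕ.sum λ j → 𝟙 ((toℕ i <ᵇ toℕ j) ∧ (toℕ (g j) <ᵇ toℕ (g i)))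

inv≡inversions : (π : Fin n → Fin n) → inv π ≡ inversions π
inv≡inversions {n} π = ≡.trans
  (sumFin≡sum (λ i → countB n λ j → ⌊ i Fin.<? j ⌋ ∧ ⌊ π j Fin.<? π i ⌋))
  (∑ℕ.sum-cong-≗ λ i → ≡.trans (countB≡sum (λ j → ⌊ i Fin.<? j ⌋ ∧ ⌊ π j Fin.<? π i ⌋))
    (∑ℕ.sum-cong-≗ λ j → ≡.cong 𝟙 (≡.cong₂ _∧_ (isYes≗does (i Fin.<? j)) (isYes≗does (π j Fin.<? π i)))))

inversions-cong : {g h : Fin n → Fin k} → g ≗ h → inversions g ≡ inversions h
inversions-cong eq = ∑ℕ.sum-cong-≗ λ i → ∑ℕ.sum-cong-≗ λ j →
  ≡.cong₂ (λ x y → 𝟙 ((toℕ i <ᵇ toℕ j) ∧ (toℕ x <ᵇ toℕ y))) (eq j) (eq i)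

inject₁<fromℕ : (i : Fin n) → (toℕ (inject₁ i) <ᵇ toℕ (fromℕ n)) ≡ true
inject₁<fromℕ Fin.zero    = ≡.refl
inject₁<fromℕ (Fin.suc i) = inject₁<fromℕ i

fromℕ≮ : ∀ {n} (j : Fin (suc n)) → (toℕ (fromℕ n) <ᵇ toℕ j) ≡ false
fromℕ≮ {n}     Fin.zero    = ≡.refl
fromℕ≮ {suc n} (Fin.suc j) = fromℕ≮ j

-- In the square of position pairs the new last row is empty, since no position follows, and the new
-- last column counts the earlier values above `a`.
inversions-snoc : (g : Fin n → Fin k) (a : Fin k) →
  inversions (snoc g a) ≡ inversions g ℕ.+ ∑ℕ.sum (λ i → 𝟙 (toℕ a <ᵇ toℕ (g i)))
inversions-snoc {n} g a = begin
  ∑ℕ.sum row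
    ≡⟨ ∑ℕ.sum-init-last row ⟩
  ∑ℕ.sum (row ∘ inject₁) ℕ.+ row (fromℕ n)
    ≡⟨ ≡.cong₂ ℕ._+_ (∑ℕ.sum-cong-≗ init-row) last-row ⟩
  ∑ℕ.sum (λ i → rowg i ℕ.+ 𝟙 (toℕ a <ᵇ toℕ (g i))) ℕ.+ 0
    ≡⟨ ℕₚ.+-identityʳ _ ⟩
  ∑ℕ.sum (λ i → rowg i ℕ.+ 𝟙 (toℕ a <ᵇ toℕ (g i)))
    ≡⟨ ∑ℕ.∑-distrib-+ rowg (λ i → 𝟙 (toℕ a <ᵇ toℕ (g i))) ⟩
  inversions g ℕ.+ ∑ℕ.sum (λ i → 𝟙 (toℕ a <ᵇ toℕ (g i))) ∎
  where
  open ≡.≡-Reasoning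
  cell : Fin (suc n) → Fin (suc n) → ℕ
  cell i j = 𝟙 ((toℕ i <ᵇ toℕ j) ∧ (toℕ (snoc g a j) <ᵇ toℕ (snoc g a i)))
  row : Fin (suc n) → ℕ
  row i = ∑ℕ.sum (cell i)
  rowg : Fin n → ℕ
  rowg i = ∑ℕ.sum λ j → 𝟙 ((toℕ i <ᵇ toℕ j) ∧ (toℕ (g j) <ᵇ toℕ (g i)))
  last-row : row (fromℕ n) ≡ 0
  last-row = ≡.trans (∑ℕ.sum-cong-≗ λ j → ≡.cong (λ b → 𝟙 (b ∧ (toℕ (snoc g a j) <ᵇ toℕ (snoc g a (fromℕ n))))) (fromℕ≮ j))
                     (∑ℕ.sum-replicate-zero (suc n))
  init-row : ∀ i → row (inject₁ i) ≡ rowg i ℕ.+ 𝟙 (toℕ a <ᵇ toℕ (g i))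
  init-row i = ≡.trans (∑ℕ.sum-init-last (cell (inject₁ i))) (≡.cong₂ ℕ._+_
    (∑ℕ.sum-cong-≗ λ j → ≡.cong 𝟙 (≡.cong₂ _∧_ (≡.cong₂ _<ᵇ_ (toℕ-inject₁ i) (toℕ-inject₁ j))
      (≡.cong₂ (λ x y → toℕ x <ᵇ toℕ y) (snoc-inject₁ g a j) (snoc-inject₁ g a i))))
    (≡.cong 𝟙 (≡.cong₂ _∧_ (inject₁<fromℕ i) (≡.cong₂ (λ x y → toℕ x <ᵇ toℕ y) (snoc-fromℕ g a) (snoc-inject₁ g a i)))))

punchIn-<ᵇ : (a : Fin (suc k)) (u v : Fin k) → (toℕ (punchIn a u) <ᵇ toℕ (punchIn a v)) ≡ (toℕ u <ᵇ toℕ v)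
punchIn-<ᵇ Fin.zero    u           v           = ≡.refl
punchIn-<ᵇ (Fin.suc a) Fin.zero    Fin.zero    = ≡.refl
punchIn-<ᵇ (Fin.suc a) Fin.zero    (Fin.suc v) = ≡.refl
punchIn-<ᵇ (Fin.suc a) (Fin.suc u) Fin.zero    = ≡.refl
punchIn-<ᵇ (Fin.suc a) (Fin.suc u) (Fin.suc v) = punchIn-<ᵇ a u v

-- Renumbering lifts every value from `a` upwards, so the tie `u = a` falls on the larger side and
-- yields a descent.
<ᵇ-punchIn : (a : Fin (suc k)) (u : Fin k) → (toℕ a <ᵇ toℕ (punchIn a u)) ≡ not (toℕ u <ᵇ toℕ a)
<ᵇ-punchIn Fin.zero    u           = ≡.refl
<ᵇ-punchIn (Fin.suc a) Fin.zero    = ≡.refl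
<ᵇ-punchIn (Fin.suc a) (Fin.suc u) = <ᵇ-punchIn a u

inversions-punchIn : (a : Fin (suc k)) (σ : Fin n → Fin k) → inversions (punchIn a ∘ σ) ≡ inversions σ
inversions-punchIn a σ = ∑ℕ.sum-cong-≗ λ i → ∑ℕ.sum-cong-≗ λ j →
  ≡.cong (λ b → 𝟙 ((toℕ i <ᵇ toℕ j) ∧ b)) (punchIn-<ᵇ a (σ j) (σ i))

-- Major index under appending and renumbering

descent : Fin k → Fin k → ℕ → ℕ
descent a b p = if toℕ b <ᵇ toℕ a then p else 0

major : (Fin n → Fin k) → ℕ
major {zero}  g = 0
major {suc n} g = ∑ℕ.sum λ (i : Fin n) → descent (g (inject₁ i)) (g (Fin.suc i)) (suc (toℕ i))

maj≡major : (π : Fin n → Fin n) → maj π ≡ major π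
maj≡major {zero}  π = ≡.refl
maj≡major {suc n} π = ≡.trans
  (sumFin≡sum (λ i → if ⌊ π (Fin.suc i) Fin.<? π (inject₁ i) ⌋ then suc (toℕ i) else 0))
  (∑ℕ.sum-cong-≗ λ i → ≡.cong (if_then suc (toℕ i) else 0) (isYes≗does (π (Fin.suc i) Fin.<? π (inject₁ i))))

major-cong : {g h : Fin n → Fin k} → g ≗ h → major g ≡ major h
major-cong {zero}  eq = ≡.refl
major-cong {suc n} eq = ∑ℕ.sum-cong-≗ λ i → ≡.cong₂ (λ x y → descent x y (suc (toℕ i))) (eq (inject₁ i)) (eq (Fin.suc i))

major-snoc : (g : Fin (suc n) → Fin k) (a : Fin k) →
  major (snoc g a) ≡ major g ℕ.+ descent (g (fromℕ n)) a (suc n)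
major-snoc {n} g a = ≡.trans (∑ℕ.sum-init-last cell) (≡.cong₂ ℕ._+_
  (∑ℕ.sum-cong-≗ λ i → ≡.trans
    (≡.cong₂ (λ x y → descent x y (suc (toℕ (inject₁ i)))) (snoc-inject₁ g a (inject₁ i)) (snoc-inject₁ (g ∘ Fin.suc) a i))
    (≡.cong (λ p → descent (g (inject₁ i)) (g (Fin.suc i)) (suc p)) (toℕ-inject₁ i)))
  (≡.trans
    (≡.cong₂ (λ x y → descent x y (suc (toℕ (fromℕ n)))) (snoc-inject₁ g a (fromℕ n)) (snoc-fromℕ (g ∘ Fin.suc) a))
    (≡.cong (λ p → descent (g (fromℕ n)) a (suc p)) (toℕ-fromℕ n))))
  where
  cell : Fin (suc n) → ℕ
  cell i = descent (snoc g a (inject₁ i)) (snoc g a (Fin.suc i)) (suc (toℕ i))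

major-punchIn : (a : Fin (suc k)) (σ : Fin n → Fin k) → major (punchIn a ∘ σ) ≡ major σ
major-punchIn {n = zero}  a σ = ≡.refl
major-punchIn {n = suc n} a σ = ∑ℕ.sum-cong-≗ λ i →
  ≡.cong (if_then suc (toℕ i) else 0) (punchIn-<ᵇ a (σ (Fin.suc i)) (σ (inject₁ i)))

-- Codes of permutations

-- A permutation is coded by the relative rank of each value among the values at earlier positions.
infixl 5 _▹_
data Code : ℕ → Set where
  []  : Code 0
  _▹_ : Code n → Fin (suc n) → Code (suc n)

decode : Code n → Fin n → Fin n
decode []      = λ ()
decode (c ▹ a) = snoc (punchIn a ∘ decode c) a

-- Bijectivity of `decode c`, in the form used for counting: a sum over positions is a sum over
-- values.
sum-decode : (c : Code n) (f : Fin n → ℕ) → ∑ℕ.sum (f ∘ decode c) ≡ ∑ℕ.sum f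
sum-decode []              f = ≡.refl
sum-decode {suc n} (c ▹ a) f = begin
  ∑ℕ.sum (f ∘ decode (c ▹ a))
    ≡⟨ ∑ℕ.sum-init-last (f ∘ decode (c ▹ a)) ⟩
  ∑ℕ.sum (f ∘ decode (c ▹ a) ∘ inject₁) ℕ.+ f (decode (c ▹ a) (fromℕ n))
    ≡⟨ ≡.cong₂ ℕ._+_ (∑ℕ.sum-cong-≗ (≡.cong f ∘ snoc-inject₁ (punchIn a ∘ decode c) a)) (≡.cong f (snoc-fromℕ (punchIn a ∘ decode c) a)) ⟩
  ∑ℕ.sum (f ∘ punchIn a ∘ decode c) ℕ.+ f a
    ≡⟨ ≡.cong (ℕ._+ f a) (sum-decode c (f ∘ punchIn a)) ⟩
  ∑ℕ.sum (f ∘ punchIn a) ℕ.+ f a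
    ≡⟨ ℕₚ.+-comm _ (f a) ⟩
  f a ℕ.+ ∑ℕ.sum (f ∘ punchIn a)
    ≡⟨ ∑ℕ.sum-remove {i = a} f ⟨
  ∑ℕ.sum f ∎
  where open ≡.≡-Reasoning

count-larger : ∀ {n} (a : Fin (suc n)) → ∑ℕ.sum {n} (λ v → 𝟙 (toℕ a <ᵇ toℕ (punchIn a v))) ≡ n ∸ toℕ a
count-larger {zero}  Fin.zero    = ≡.refl
count-larger {suc n} Fin.zero    = ≡.cong suc (count-larger {n} Fin.zero)
count-larger {suc n} (Fin.suc a) = count-larger a

inversions-decode : (c : Code n) (a : Fin (suc n)) → inversions (decode (c ▹ a)) ≡ inversions (decode c) ℕ.+ (n ∸ toℕ a)
inversions-decode c a = ≡.trans (inversions-snoc (punchIn a ∘ decode c) a) (≡.cong₂ ℕ._+_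
  (inversions-punchIn a (decode c))
  (≡.trans (sum-decode c (λ v → 𝟙 (toℕ a <ᵇ toℕ (punchIn a v)))) (count-larger a)))

-- The last value of `decode (c ▹ u)` is `u` itself, so the new comparison depends on `u` and `a`
-- alone. This is what makes the last value a sufficient state for the transfer below.
major-decode : (c : Code n) (u : Fin (suc n)) (a : Fin (suc (suc n))) →
  major (decode (c ▹ u ▹ a)) ≡ major (decode (c ▹ u)) ℕ.+ (if toℕ u <ᵇ toℕ a then 0 else suc n)
major-decode {n} c u a = ≡.trans (major-snoc (punchIn a ∘ decode (c ▹ u)) a) (≡.cong₂ ℕ._+_
  (major-punchIn a (decode (c ▹ u)))
  (≡.trans (≡.cong (λ z → descent (punchIn a z) a (suc n)) (snoc-fromℕ (punchIn u ∘ decode c) u))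
    (≡.trans (≡.cong (if_then suc n else 0) (<ᵇ-punchIn a u)) (if-not (toℕ u <ᵇ toℕ a)))))
  where
  if-not : ∀ b → (if not b then suc n else 0) ≡ (if b then 0 else suc n)
  if-not true  = ≡.refl
  if-not false = ≡.refl

-- Ring identities, powers and finite sums

module Ring {c ℓ : Level} (R : CommutativeRing c ℓ) where
  open CommutativeRing R hiding (zero)
  open import Algebra.Properties.Ring ring using (x∙y⁻¹≈ε⇒x≈y)
  open import Algebra.Properties.Semiring.Sum semiring
  open import Algebra.Solver.Ring.NaturalCoefficients.Default commutativeSemiring
    using (solve; _:=_; _:+_; _:*_; con)
  open import Relation.Binary.Reasoning.Setoid setoid

  -- The solver handles only semirings, so `1- x` enters it as an atom and facts such as
  -- `x + 1- x ≈ 1#` are supplied by hand.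
  1-_ : Carrier → Carrier
  1- x = 1# - x

  x+[1-x]≈1 : ∀ x → x + 1- x ≈ 1#
  x+[1-x]≈1 x = begin
    x + (1# - x)  ≈⟨ +-comm x _ ⟩
    1# - x + x    ≈⟨ +-assoc 1# (- x) x ⟩
    1# + (- x + x) ≈⟨ +-congˡ (-‿inverseˡ x) ⟩
    1# + 0#       ≈⟨ +-identityʳ 1# ⟩
    1#            ∎

  1-‿cong : ∀ {x y} → x ≈ y → 1- x ≈ 1- y
  1-‿cong x≈y = +-congˡ (-‿cong x≈y)

  1-1≈0 : 1- 1# ≈ 0#
  1-1≈0 = -‿inverseʳ 1#

  1-‿unique : ∀ {x w} → x + w ≈ 1# → w ≈ 1- x
  1-‿unique {x} {w} eq = begin
    w            ≈⟨ +-identityʳ w ⟨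
    w + 0#       ≈⟨ +-congˡ (-‿inverseʳ x) ⟨
    w + (x - x)  ≈⟨ +-assoc w x (- x) ⟨
    w + x - x    ≈⟨ +-congʳ (trans (+-comm w x) eq) ⟩
    1- x         ∎

  1-‿* : ∀ x y → 1- x + x * 1- y ≈ 1- (x * y)
  1-‿* x y = 1-‿unique (begin
    x * y + (1- x + x * 1- y)  ≈⟨ solve 4 (λ x y x′ y′ → x :* y :+ (x′ :+ x :* y′) := x :* (y :+ y′) :+ x′) refl x y (1- x) (1- y) ⟩
    x * (y + 1- y) + 1- x      ≈⟨ +-congʳ (*-congˡ (x+[1-x]≈1 y)) ⟩
    x * 1# + 1- x              ≈⟨ +-congʳ (*-identityʳ x) ⟩
    x + 1- x                   ≈⟨ x+[1-x]≈1 x ⟩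
    1#                         ∎)

  infixr 8 _^_
  _^_ : Carrier → ℕ → Carrier
  _^_ = pow R

  ^-+ : ∀ x m n → x ^ (m ℕ.+ n) ≈ x ^ m * x ^ n
  ^-+ x zero    n = sym (*-identityˡ _)
  ^-+ x (suc m) n = trans (*-congˡ (^-+ x m n)) (sym (*-assoc x _ _))

  ^-* : ∀ x m n → x ^ (m ℕ.* n) ≈ (x ^ m) ^ n
  ^-* x m zero    rewrite ℕₚ.*-zeroʳ m = refl
  ^-* x m (suc n) rewrite ℕₚ.*-suc m n = trans (^-+ x m (m ℕ.* n)) (*-congˡ (^-* x m n))

  ∑< : ℕ → (ℕ → Carrier) → Carrier
  ∑< n f = sum {n} (f ∘ toℕ)

  ∑<-cong : ∀ n {f g} → (∀ j → j ℕ.< n → f j ≈ g j) → ∑< n f ≈ ∑< n g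
  ∑<-cong n eq = sum-cong-≋ (λ i → eq (toℕ i) (toℕ<n i))

  ∑<-last : ∀ n f → ∑< (suc n) f ≈ ∑< n f + f n
  ∑<-last n f = trans (sum-init-last (f ∘ toℕ))
    (+-cong (sum-cong-≋ {n} λ i → reflexive (≡.cong f (toℕ-inject₁ i))) (reflexive (≡.cong f (toℕ-fromℕ n))))

  ∑<-+ : ∀ n f g → ∑< n (λ j → f j + g j) ≈ ∑< n f + ∑< n g
  ∑<-+ n f g = ∑-distrib-+ {n} (f ∘ toℕ) (g ∘ toℕ)

  ∑<-* : ∀ n x f → ∑< n (λ j → x * f j) ≈ x * ∑< n f
  ∑<-* n x f = sym (*-distribˡ-sum {n} x (f ∘ toℕ))

  -- Gaussian binomial coefficients

  module qBinomial (q : Carrier) where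

    qbin : ℕ → ℕ → Carrier
    qbin n       zero    = 1#
    qbin zero    (suc k) = 0#
    qbin (suc n) (suc k) = qbin n k + q ^ suc k * qbin n (suc k)

    n<k⇒qbin≈0 : ∀ {n k} → n ℕ.< k → qbin n k ≈ 0#
    n<k⇒qbin≈0 {zero}  {suc k} _         = refl
    n<k⇒qbin≈0 {suc n} {suc k} (s≤s n<k) = begin
      qbin n k + q ^ suc k * qbin n (suc k)
        ≈⟨ +-cong (n<k⇒qbin≈0 n<k) (*-congˡ (n<k⇒qbin≈0 (ℕₚ.m<n⇒m<1+n n<k))) ⟩
      0# + q ^ suc k * 0#
        ≈⟨ trans (+-identityˡ _) (zeroʳ _) ⟩
      0# ∎

    qbin-self : ∀ n → qbin n n ≈ 1#
    qbin-self zero    = refl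
    qbin-self (suc n) = begin
      qbin n n + q ^ suc n * qbin n (suc n)
        ≈⟨ +-cong (qbin-self n) (*-congˡ (n<k⇒qbin≈0 (ℕₚ.n<1+n n))) ⟩
      1# + q ^ suc n * 0#
        ≈⟨ trans (+-congˡ (zeroʳ _)) (+-identityʳ 1#) ⟩
      1# ∎

    -- Division-free form of the quotient of neighbouring coefficients. In the general step Pascal's
    -- rule and the two smaller cases bring both sides to 1 - q^(a+b+3) times the common coefficient
    -- `X`.
    qbin-ratio : ∀ a b → 1- (q ^ suc b) * qbin (suc (a ℕ.+ b)) a ≈ 1- (q ^ suc a) * qbin (suc (a ℕ.+ b)) (suc a)
    qbin-ratio zero zero = *-congˡ (sym (qbin-self 1))
    qbin-ratio zero (suc b) = begin
      1- (q ^ suc (suc b)) * 1#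
        ≈⟨ *-identityʳ _ ⟩
      1- (q * q ^ suc b)
        ≈⟨ 1-‿* q (q ^ suc b) ⟨
      1- q + q * 1- (q ^ suc b)
        ≈⟨ +-cong (1-‿cong (*-identityʳ q)) (trans (*-congʳ (*-identityʳ q)) (*-congˡ (*-identityʳ _))) ⟨
      1- (q ^ 1) + q ^ 1 * (1- (q ^ suc b) * 1#)
        ≈⟨ +-congˡ (*-congˡ (qbin-ratio zero b)) ⟩
      1- (q ^ 1) + q ^ 1 * (1- (q ^ 1) * qbin (suc b) 1)
        ≈⟨ solve 3 (λ u p z → u :+ p :* (u :* z) := u :* (con 1 :+ p :* z)) refl (1- (q ^ 1)) (q ^ 1) (qbin (suc b) 1) ⟩
      1- (q ^ 1) * (1# + q ^ 1 * qbin (suc b) 1) ∎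
    qbin-ratio (suc a) zero = begin
      1- (q ^ 1) * (qbin N a + q ^ suc a * qbin N (suc a))
        ≈⟨ *-congˡ (+-congˡ (trans (*-congˡ (full (suc a))) (*-identityʳ _))) ⟩
      1- (q ^ 1) * (qbin N a + q ^ suc a)
        ≈⟨ distribˡ _ _ _ ⟩
      1- (q ^ 1) * qbin N a + 1- (q ^ 1) * q ^ suc a
        ≈⟨ +-congʳ (qbin-ratio a zero) ⟩
      1- (q ^ suc a) * qbin N (suc a) + 1- (q ^ 1) * q ^ suc a
        ≈⟨ +-cong (trans (*-congˡ (full (suc a))) (*-identityʳ _)) (*-comm _ _) ⟩
      1- (q ^ suc a) + q ^ suc a * 1- (q ^ 1)
        ≈⟨ 1-‿* (q ^ suc a) (q ^ 1) ⟩
      1- (q ^ suc a * q ^ 1)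
        ≈⟨ 1-‿cong (trans (*-comm _ _) (*-congʳ (*-identityʳ q))) ⟩
      1- (q ^ suc (suc a))
        ≈⟨ *-identityʳ _ ⟨
      1- (q ^ suc (suc a)) * 1#
        ≈⟨ *-congˡ (full (suc (suc a))) ⟨
      1- (q ^ suc (suc a)) * qbin (suc N) (suc (suc a)) ∎
      where
      N = suc (a ℕ.+ 0)
      full : ∀ n → qbin (n ℕ.+ 0) n ≈ 1#
      full n = ≡.subst (λ s → qbin s n ≈ 1#) (≡.sym (ℕₚ.+-identityʳ n)) (qbin-self n)
    qbin-ratio (suc a) (suc b) = begin
      v₂ * (qbin N a + q ^ suc a * X)
        ≈⟨ solve 4 (λ v y p x → v :* (y :+ p :* x) := v :* y :+ p :* v :* x) refl v₂ (qbin N a) (q ^ suc a) X ⟩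
      v₂ * qbin N a + q ^ suc a * v₂ * X
        ≈⟨ +-congʳ (qbin-ratio a (suc b)) ⟩
      1- (q ^ suc a) * X + q ^ suc a * v₂ * X
        ≈⟨ distribʳ X _ _ ⟨
      (1- (q ^ suc a) + q ^ suc a * v₂) * X
        ≈⟨ *-congʳ (1-‿* _ _) ⟩
      1- (q ^ suc a * q ^ suc (suc b)) * X
        ≈⟨ *-congʳ (1-‿cong (begin
             q ^ suc a * q ^ suc (suc b)    ≈⟨ ^-+ q (suc a) (suc (suc b)) ⟨
             q ^ (suc a ℕ.+ suc (suc b))    ≡⟨ ≡.cong (q ^_) (ℕₚ.+-suc (suc a) (suc b)) ⟩
             q ^ (suc (suc a) ℕ.+ suc b)    ≈⟨ ^-+ q (suc (suc a)) (suc b) ⟩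
             q ^ suc (suc a) * q ^ suc b    ∎)) ⟩
      1- (q ^ suc (suc a) * q ^ suc b) * X
        ≈⟨ *-congʳ (1-‿* _ _) ⟨
      (u₂ + q ^ suc (suc a) * 1- (q ^ suc b)) * X
        ≈⟨ solve 4 (λ u p w x → (u :+ p :* w) :* x := u :* x :+ p :* (w :* x)) refl u₂ (q ^ suc (suc a)) (1- (q ^ suc b)) X ⟩
      u₂ * X + q ^ suc (suc a) * (1- (q ^ suc b) * X)
        ≈⟨ +-congˡ (*-congˡ ratio′) ⟩
      u₂ * X + q ^ suc (suc a) * (u₂ * qbin N (suc (suc a)))
        ≈⟨ solve 4 (λ u x p y → u :* x :+ p :* (u :* y) := u :* (x :+ p :* y)) refl u₂ X (q ^ suc (suc a)) (qbin N (suc (suc a))) ⟩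
      u₂ * (X + q ^ suc (suc a) * qbin N (suc (suc a))) ∎
      where
      N  = suc (a ℕ.+ suc b)
      X  = qbin N (suc a)
      u₂ = 1- (q ^ suc (suc a))
      v₂ = 1- (q ^ suc (suc b))
      ratio′ : 1- (q ^ suc b) * X ≈ u₂ * qbin N (suc (suc a))
      ratio′ = ≡.subst (λ s → 1- (q ^ suc b) * qbin (suc s) (suc a) ≈ u₂ * qbin (suc s) (suc (suc a)))
                 (≡.sym (ℕₚ.+-suc a b)) (qbin-ratio (suc a) b)

    -- The two Pascal rules agree: `X + q ^ suc a * Y ≈ Y + q ^ suc b * X` is a rearrangement of
    -- `qbin-ratio`, after which induction exchanges the lower indices.
    qbin-sym : ∀ a b → qbin (a ℕ.+ b) a ≈ qbin (a ℕ.+ b) b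
    qbin-sym zero    b    = sym (qbin-self b)
    qbin-sym (suc a) zero rewrite ℕₚ.+-identityʳ a = qbin-self (suc a)
    qbin-sym (suc a) (suc b) = begin
      X + q ^ suc a * Y
        ≈⟨ +-congʳ (*-identityʳ X) ⟨
      X * 1# + q ^ suc a * Y
        ≈⟨ +-congʳ (*-congˡ (x+[1-x]≈1 (q ^ suc b))) ⟨
      X * (q ^ suc b + 1- (q ^ suc b)) + q ^ suc a * Y
        ≈⟨ solve 5 (λ x p w s y → x :* (p :+ w) :+ s :* y := p :* x :+ w :* x :+ s :* y) refl X (q ^ suc b) (1- (q ^ suc b)) (q ^ suc a) Y ⟩
      q ^ suc b * X + 1- (q ^ suc b) * X + q ^ suc a * Y
        ≈⟨ +-congʳ (+-congˡ ratio) ⟩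
      q ^ suc b * X + 1- (q ^ suc a) * Y + q ^ suc a * Y
        ≈⟨ solve 4 (λ z w s y → z :+ w :* y :+ s :* y := (s :+ w) :* y :+ z) refl (q ^ suc b * X) (1- (q ^ suc a)) (q ^ suc a) Y ⟩
      (q ^ suc a + 1- (q ^ suc a)) * Y + q ^ suc b * X
        ≈⟨ +-congʳ (trans (*-congʳ (x+[1-x]≈1 (q ^ suc a))) (*-identityˡ Y)) ⟩
      Y + q ^ suc b * X
        ≈⟨ +-cong (≡.subst (λ s → qbin s (suc a) ≈ qbin s b) (≡.sym (ℕₚ.+-suc a b)) (qbin-sym (suc a) b)) (*-congˡ (qbin-sym a (suc b))) ⟩
      qbin (a ℕ.+ suc b) b + q ^ suc b * qbin (a ℕ.+ suc b) (suc b) ∎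
      where
      X = qbin (a ℕ.+ suc b) a
      Y = qbin (a ℕ.+ suc b) (suc a)
      ratio : 1- (q ^ suc b) * X ≈ 1- (q ^ suc a) * Y
      ratio = ≡.subst (λ s → 1- (q ^ suc b) * qbin s a ≈ 1- (q ^ suc a) * qbin s (suc a))
                (≡.sym (ℕₚ.+-suc a b)) (qbin-ratio a b)

    -- The operator L_n of the overview.
    qsum : ℕ → (ℕ → Carrier) → Carrier
    qsum n f = ∑< (suc n) (λ j → qbin n j * f j)

    qsum-cong : ∀ n {f g} → (∀ j → j ℕ.≤ n → f j ≈ g j) → qsum n f ≈ qsum n g
    qsum-cong n {f} {g} eq = ∑<-cong (suc n) {λ j → qbin n j * f j} {λ j → qbin n j * g j}
      (λ j j<1+n → *-congˡ (eq j (ℕₚ.≤-pred j<1+n)))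

    qsum-* : ∀ n x f → qsum n (λ j → x * f j) ≈ x * qsum n f
    qsum-* n x f = trans
      (∑<-cong (suc n) λ j _ → solve 3 (λ b x y → b :* (x :* y) := x :* (b :* y)) refl (qbin n j) x (f j))
      (∑<-* (suc n) x (λ j → qbin n j * f j))

    -- Pascal's rule under the sum, with the power of `q` moved from the coefficient onto the
    -- function.
    qsum-suc : ∀ n f → qsum (suc n) f ≈ qsum n (f ∘ suc) + qsum n (λ j → q ^ j * f j)
    qsum-suc n f = begin
      1# * f 0 + ∑< (suc n) (λ j → (qbin n j + q ^ suc j * qbin n (suc j)) * f (suc j))
        ≈⟨ +-congˡ (∑<-cong (suc n) λ j _ → solve 4 (λ a p b x → (a :+ p :* b) :* x := a :* x :+ b :* (p :* x)) refl (qbin n j) (q ^ suc j) (qbin n (suc j)) (f (suc j))) ⟩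
      1# * f 0 + ∑< (suc n) (λ j → qbin n j * f (suc j) + g (suc j))
        ≈⟨ +-congˡ (∑<-+ (suc n) (λ j → qbin n j * f (suc j)) (g ∘ suc)) ⟩
      1# * f 0 + (qsum n (f ∘ suc) + ∑< (suc n) (g ∘ suc))
        ≈⟨ solve 3 (λ x y z → con 1 :* x :+ (y :+ z) := y :+ (con 1 :* (con 1 :* x) :+ z)) refl (f 0) (qsum n (f ∘ suc)) (∑< (suc n) (g ∘ suc)) ⟩
      qsum n (f ∘ suc) + ∑< (suc (suc n)) g
        ≈⟨ +-congˡ (∑<-last (suc n) g) ⟩
      qsum n (f ∘ suc) + (∑< (suc n) g + g (suc n))
        ≈⟨ +-congˡ (trans (+-congˡ (trans (*-congʳ (n<k⇒qbin≈0 (ℕₚ.n<1+n n))) (zeroˡ _))) (+-identityʳ _)) ⟩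
      qsum n (f ∘ suc) + qsum n (λ j → q ^ j * f j) ∎
      where
      g : ℕ → Carrier
      g j = qbin n j * (q ^ j * f j)

    -- Periodicity at a root of unity

    module Lucas (dom : IsIntegralDomain R) (m : ℕ) (prim : IsPrimitiveRoot R (suc m) q) where

      -- Induction on `a` along `qbin-ratio`, whose left side is zero: at the start because
      -- `q ^ suc m ≈ 1#`, later because the previous coefficient vanishes. Primitivity keeps
      -- `1- (q ^ suc a)` away from zero, and the domain property cancels it.
      qbin-vanish : ∀ a b → suc (a ℕ.+ b) ≡ m → qbin (suc m) (suc a) ≈ 0#
      qbin-vanish a b eq with proj₂ dom _ _ 1-q^a*qbin≈0
        where
        b′ = suc b
        sum≡ : a ℕ.+ b′ ≡ m
        sum≡ = ≡.trans (ℕₚ.+-suc a b) eq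
        left : ∀ a → a ℕ.+ b′ ≡ m → 1- (q ^ suc b′) * qbin (suc m) a ≈ 0#
        left zero    ≡.refl = trans (*-identityʳ _) (trans (1-‿cong (proj₁ prim)) 1-1≈0)
        left (suc a) e    = trans (*-congˡ (qbin-vanish a b′ e)) (zeroʳ _)
        1-q^a*qbin≈0 : 1- (q ^ suc a) * qbin (suc m) (suc a) ≈ 0#
        1-q^a*qbin≈0 = trans (sym (≡.subst (λ s → 1- (q ^ suc b′) * qbin (suc s) a ≈ 1- (q ^ suc a) * qbin (suc s) (suc a)) sum≡ (qbin-ratio a b′))) (left a sum≡)
      ... | inj₂ z = z
      ... | inj₁ z = ⊥-elim (proj₂ prim (suc a) z<s (s<s a<m) (sym (x∙y⁻¹≈ε⇒x≈y _ _ z)))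
        where
        a<m : a ℕ.< m
        a<m = ≡.subst (a ℕ.<_) eq (s≤s (ℕₚ.m≤m+n a b))

      qsum-period : ∀ f → qsum (suc m) f ≈ f 0 + f (suc m)
      qsum-period f = begin
        1# * f 0 + ∑< (suc m) g
          ≈⟨ +-cong (*-identityˡ _) (∑<-last m g) ⟩
        f 0 + (∑< m g + g m)
          ≈⟨ +-congˡ (+-cong middle (trans (*-congʳ (qbin-self (suc m))) (*-identityˡ _))) ⟩
        f 0 + (0# + f (suc m))
          ≈⟨ +-congˡ (+-identityˡ _) ⟩
        f 0 + f (suc m) ∎
        where
        g : ℕ → Carrier
        g j = qbin (suc m) (suc j) * f (suc j)
        middle : ∑< m g ≈ 0#
        middle = trans (∑<-cong m {g} {λ _ → 0#} λ j j<m → trans (*-congʳ (qbin-vanish j (m ∸ suc j) (ℕₚ.m+[n∸m]≡n j<m))) (zeroˡ _))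
                   (sum-replicate-zero m)

      -- Both sides obey the recursion `qsum-suc`: the weight `q ^ j` does not notice a shift by
      -- `suc m`, as `q ^ suc m ≈ 1#`.
      qsum-shift : ∀ n f → qsum (suc m ℕ.+ n) f ≈ qsum n f + qsum n (f ∘ (suc m ℕ.+_))
      qsum-shift zero f rewrite ℕₚ.+-identityʳ m = trans (qsum-period f) (sym (+-cong single single))
        where
        single : ∀ {x} → 1# * x + 0# ≈ x
        single = trans (+-identityʳ _) (*-identityˡ _)
      qsum-shift (suc n) f rewrite ℕₚ.+-suc m n = begin
        qsum (suc (M ℕ.+ n)) f
          ≈⟨ qsum-suc (M ℕ.+ n) f ⟩
        qsum (M ℕ.+ n) (f ∘ suc) + qsum (M ℕ.+ n) (λ j → q ^ j * f j)
          ≈⟨ +-cong (qsum-shift n (f ∘ suc)) (qsum-shift n (λ j → q ^ j * f j)) ⟩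
        (qsum n (f ∘ suc) + qsum n (f ∘ suc ∘ (M ℕ.+_))) + (qsum n (λ j → q ^ j * f j) + qsum n (λ j → q ^ (M ℕ.+ j) * f (M ℕ.+ j)))
          ≈⟨ +-cong (+-congˡ (qsum-cong n {f ∘ suc ∘ (M ℕ.+_)} {f ∘ (M ℕ.+_) ∘ suc} λ j _ → reflexive (≡.cong f (≡.sym (ℕₚ.+-suc M j)))))
                    (+-congˡ (qsum-cong n {λ j → q ^ (M ℕ.+ j) * f (M ℕ.+ j)} {λ j → q ^ j * f (M ℕ.+ j)} λ j _ → *-congʳ (trans (^-+ q M j) (trans (*-congʳ (proj₁ prim)) (*-identityˡ _))))) ⟩
        (qsum n (f ∘ suc) + qsum n (f ∘ (M ℕ.+_) ∘ suc)) + (qsum n (λ j → q ^ j * f j) + qsum n (λ j → q ^ j * f (M ℕ.+ j)))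
          ≈⟨ solve 4 (λ a b c d → (a :+ b) :+ (c :+ d) := (a :+ c) :+ (b :+ d)) refl _ _ _ _ ⟩
        (qsum n (f ∘ suc) + qsum n (λ j → q ^ j * f j)) + (qsum n (f ∘ (M ℕ.+_) ∘ suc) + qsum n (λ j → q ^ j * f (M ℕ.+ j)))
          ≈⟨ +-cong (qsum-suc n f) (qsum-suc n (f ∘ (M ℕ.+_))) ⟨
        qsum (suc n) f + qsum (suc n) (f ∘ (M ℕ.+_)) ∎
        where M = suc m

      -- q-Lucas turns the sum into a binomial expansion of (x + y) ^ k = 1.
      qsum-geometric : ∀ {x y} → x + y ≈ 1# → ∀ k i d (g f : ℕ → Carrier) →
        (∀ a e b → a ℕ.+ e ≡ k → b ℕ.≤ i → f (suc m ℕ.* a ℕ.+ b) ≈ d * (x ^ a * y ^ e * g b)) →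
        qsum (suc m ℕ.* k ℕ.+ i) f ≈ d * qsum i g
      qsum-geometric {x} {y} x+y≈1 zero i d g f eq rewrite ℕₚ.*-zeroʳ m =
        trans (qsum-cong i {f} {λ j → d * g j} λ j j≤i → trans (f≈ j j≤i) (*-congˡ (trans (*-congʳ (*-identityˡ 1#)) (*-identityˡ (g j)))))
              (qsum-* i d g)
        where
        f≈ : ∀ j → j ℕ.≤ i → f j ≈ d * (1# * 1# * g j)
        f≈ j j≤i = ≡.subst (λ z → f (z ℕ.+ j) ≈ d * (1# * 1# * g j)) (ℕₚ.*-zeroʳ (suc m)) (eq 0 0 j ≡.refl j≤i)
      qsum-geometric {x} {y} x+y≈1 (suc k) i d g f eq = begin
        qsum (M ℕ.* suc k ℕ.+ i) f
          ≡⟨ ≡.cong (λ N → qsum N f) (shift k i) ⟩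
        qsum (M ℕ.+ (M ℕ.* k ℕ.+ i)) f
          ≈⟨ qsum-shift (M ℕ.* k ℕ.+ i) f ⟩
        qsum (M ℕ.* k ℕ.+ i) f + qsum (M ℕ.* k ℕ.+ i) (f ∘ (M ℕ.+_))
          -- The constant `d` collects one factor per block of length `M`: `y` if the argument
          -- stays, `x` if it is shifted.
          ≈⟨ +-cong (qsum-geometric x+y≈1 k i (d * y) g f low) (qsum-geometric x+y≈1 k i (d * x) g (f ∘ (M ℕ.+_)) high) ⟩
        d * y * qsum i g + d * x * qsum i g
          ≈⟨ solve 4 (λ d y s x → d :* y :* s :+ d :* x :* s := (x :+ y) :* (d :* s)) refl d y (qsum i g) x ⟩
        (x + y) * (d * qsum i g)
          ≈⟨ trans (*-congʳ x+y≈1) (*-identityˡ _) ⟩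
        d * qsum i g ∎
        where
        M = suc m
        shift : ∀ a b → M ℕ.* suc a ℕ.+ b ≡ M ℕ.+ (M ℕ.* a ℕ.+ b)
        shift a b = ≡.trans (≡.cong (ℕ._+ b) (ℕₚ.*-suc M a)) (ℕₚ.+-assoc M (M ℕ.* a) b)
        low : ∀ a e b → a ℕ.+ e ≡ k → b ℕ.≤ i → f (M ℕ.* a ℕ.+ b) ≈ d * y * (x ^ a * y ^ e * g b)
        low a e b a+e b≤i = trans (eq a (suc e) b (≡.trans (ℕₚ.+-suc a e) (≡.cong suc a+e)) b≤i)
          (solve 5 (λ d p y s g → d :* (p :* (y :* s) :* g) := d :* y :* (p :* s :* g)) refl d (x ^ a) y (y ^ e) (g b))
        high : ∀ a e b → a ℕ.+ e ≡ k → b ℕ.≤ i → f (M ℕ.+ (M ℕ.* a ℕ.+ b)) ≈ d * x * (x ^ a * y ^ e * g b)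
        high a e b a+e b≤i = trans (reflexive (≡.cong f (≡.sym (shift a b)))) (trans (eq (suc a) e b (≡.cong suc a+e) b≤i)
          (solve 5 (λ d x p s g → d :* (x :* p :* s :* g) := d :* x :* (p :* s :* g)) refl d x (x ^ a) (y ^ e) (g b)))

  -- The recurrence by transfer of the last value

  module Transfer (t r : Carrier) where
    open qBinomial t

    -- α n v is the part of A (suc n) t r contributed by the permutations with last value v (see ∑C-weight),
    -- and B n is A n t r (see A≈B).
    α : ℕ → ℕ → Carrier
    α zero    v = 1#
    α (suc n) v = t ^ (suc n ∸ v) * (r ^ suc n * ∑< (suc n) (α n) + 1- (r ^ suc n) * ∑< v (α n))

    B : ℕ → Carrier
    B zero    = 1#
    B (suc n) = ∑< (suc n) (α n)

    -- Appends a letter of value v to words on s letters, keeping only the ascents.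
    append : ℕ → (ℕ → Carrier) → ℕ → Carrier
    append s w v = t ^ (s ∸ v) * ∑< v w

    -- Accumulating in the weight makes an appended weight with `j` letters to go definitionally the
    -- old weight with `suc j`, which lets `total-α` recurse on `s` for all `j` at once.
    total : ℕ → ℕ → (ℕ → Carrier) → Carrier
    total s zero    w = ∑< s w
    total s (suc j) w = total (suc s) j (append s w)

    append-cong : ∀ s {w w′} → (∀ v → v ℕ.< s → w v ≈ w′ v) →
                  ∀ v → v ℕ.< suc s → append s w v ≈ append s w′ v
    append-cong s {w} {w′} eq v (s≤s v≤s) = *-congˡ (∑<-cong v {w} {w′} λ u u<v → eq u (ℕₚ.<-≤-trans u<v v≤s))

    total-cong : ∀ s j {w w′} → (∀ v → v ℕ.< s → w v ≈ w′ v) → total s j w ≈ total s j w′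
    total-cong s zero    {w} {w′} eq = ∑<-cong s {w} {w′} eq
    total-cong s (suc j) {w} {w′} eq = total-cong (suc s) j (append-cong s {w} {w′} eq)

    ∑<-linear : ∀ n x y w w′ → ∑< n (λ v → x * w v + y * w′ v) ≈ x * ∑< n w + y * ∑< n w′
    ∑<-linear n x y w w′ = trans (∑<-+ n (λ v → x * w v) (λ v → y * w′ v)) (+-cong (∑<-* n x w) (∑<-* n y w′))

    total-linear : ∀ s j x y w w′ → total s j (λ v → x * w v + y * w′ v) ≈ x * total s j w + y * total s j w′
    total-linear s zero    x y w w′ = ∑<-linear s x y w w′
    total-linear s (suc j) x y w w′ = trans
      (total-cong (suc s) j λ v _ → trans (*-congˡ (∑<-linear v x y w w′))
        (solve 5 (λ p x a y b → p :* (x :* a :+ y :* b) := x :* (p :* a) :+ y :* (p :* b)) refl (t ^ (s ∸ v)) x (∑< v w) y (∑< v w′)))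
      (total-linear (suc s) j x y (append s w) (append s w′))

    -- Arrangements of N + 1 letters ending in an increasing run of l + 1 letters with last value v, by the
    -- inversions involving the run: each of the N - v larger letters precedes all of it.
    runs : ℕ → ℕ → ℕ → Carrier
    runs N l v = t ^ (suc l ℕ.* (N ∸ v)) * qbin v l

    -- Pascal's rule, one value `v` at a time. The complement `e` is a separate argument, so that it
    -- can grow as `v` shrinks without truncated subtraction.
    hockey-stick : ∀ N l v e → v ℕ.+ e ≡ suc N → ∑< v (runs N l) ≈ t ^ (suc l ℕ.* e) * qbin v (suc l)
    hockey-stick N l zero    e _  = sym (zeroʳ _)
    hockey-stick N l (suc v) e eq = begin
      ∑< (suc v) (runs N l)
        ≈⟨ ∑<-last v (runs N l) ⟩
      ∑< v (runs N l) + t ^ (p ℕ.* (N ∸ v)) * qbin v l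
        ≈⟨ +-cong (hockey-stick N l v (suc e) (≡.trans (ℕₚ.+-suc v e) eq)) (*-congʳ (reflexive (≡.cong (λ d → t ^ (p ℕ.* d)) N∸v≡e))) ⟩
      t ^ (p ℕ.* suc e) * qbin v p + t ^ (p ℕ.* e) * qbin v l
        ≈⟨ +-congʳ (*-congʳ (trans (reflexive (≡.cong (t ^_) (ℕₚ.*-suc p e))) (^-+ t p (p ℕ.* e)))) ⟩
      t ^ p * t ^ (p ℕ.* e) * qbin v p + t ^ (p ℕ.* e) * qbin v l
        ≈⟨ solve 4 (λ a b x y → a :* b :* x :+ b :* y := b :* (y :+ a :* x)) refl (t ^ p) (t ^ (p ℕ.* e)) (qbin v p) (qbin v l) ⟩
      t ^ (p ℕ.* e) * (qbin v l + t ^ p * qbin v p) ∎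
      where
      p = suc l
      N∸v≡e : N ∸ v ≡ e
      N∸v≡e = ≡.trans (≡.cong (_∸ v) (≡.sym (ℕₚ.suc-injective eq))) (ℕₚ.m+n∸m≡n v e)

    append-runs : ∀ N l v → v ℕ.< suc (suc N) → append (suc N) (runs N l) v ≈ runs (suc N) (suc l) v
    append-runs N l v (s≤s v≤1+N) = begin
      t ^ e * ∑< v (runs N l)
        ≈⟨ *-congˡ (hockey-stick N l v e (ℕₚ.m+[n∸m]≡n v≤1+N)) ⟩
      t ^ e * (t ^ (suc l ℕ.* e) * qbin v (suc l))
        ≈⟨ *-assoc _ _ _ ⟨
      t ^ e * t ^ (suc l ℕ.* e) * qbin v (suc l)
        ≈⟨ *-congʳ (^-+ t e (suc l ℕ.* e)) ⟨
      t ^ (e ℕ.+ suc l ℕ.* e) * qbin v (suc l) ∎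
      where e = suc N ∸ v

    -- Each appended ascent prolongs the final run by one letter, so the weight stays of the form
    -- `runs` until the hockey stick sums over all last values.
    total-runs : ∀ N l j → total (suc N) j (runs N l) ≈ qbin (suc N ℕ.+ j) (suc l ℕ.+ j)
    total-runs N l zero rewrite ℕₚ.+-identityʳ N | ℕₚ.+-identityʳ l = begin
      ∑< (suc N) (runs N l)
        ≈⟨ hockey-stick N l (suc N) 0 (ℕₚ.+-identityʳ (suc N)) ⟩
      t ^ (suc l ℕ.* 0) * qbin (suc N) (suc l)
        ≈⟨ *-congʳ (reflexive (≡.cong (t ^_) (ℕₚ.*-zeroʳ (suc l)))) ⟩
      1# * qbin (suc N) (suc l)
        ≈⟨ *-identityˡ _ ⟩
      qbin (suc N) (suc l) ∎
    total-runs N l (suc j) rewrite ℕₚ.+-suc N j | ℕₚ.+-suc l j =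
      trans (total-cong (suc (suc N)) j (append-runs N l)) (total-runs (suc N) (suc l) j)

    -- The case of a run that starts with one letter. Symmetry then trades the run's final length
    -- `suc j` for the number `k` of letters before it, the index of the recurrence.
    total-powers : ∀ k j → total (suc k) j (λ v → t ^ (k ∸ v)) ≈ qbin (suc k ℕ.+ j) k
    total-powers k j = begin
      total (suc k) j (λ v → t ^ (k ∸ v))
        ≈⟨ total-cong (suc k) j (λ v _ → trans (reflexive (≡.cong (t ^_) (≡.sym (ℕₚ.*-identityˡ (k ∸ v))))) (sym (*-identityʳ _))) ⟩
      total (suc k) j (runs k 0)
        ≈⟨ total-runs k 0 j ⟩
      qbin (suc k ℕ.+ j) (suc j)
        ≈⟨ ≡.subst (λ s → qbin s k ≈ qbin s (suc j)) (ℕₚ.+-suc k j) (qbin-sym k (suc j)) ⟨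
      qbin (suc k ℕ.+ j) k ∎

    -- Quotients of q-Pochhammer symbols and the recurrence

    -- The quotient (r)ₛ / (r)_b for b ≤ s; junk value 1 otherwise.
    poch : ℕ → ℕ → Carrier
    poch b zero    = 1#
    poch b (suc s) with b ℕ.≤? s
    ... | yes _ = poch b s * 1- (r ^ suc s)
    ... | no  _ = 1#

    poch-suc : ∀ {b s} → b ℕ.≤ s → poch b (suc s) ≈ poch b s * 1- (r ^ suc s)
    poch-suc {b} {s} b≤s with b ℕ.≤? s
    ... | yes _   = refl
    ... | no  b≰s = ⊥-elim (b≰s b≤s)

    -- On the positive diagonal the default branch of `poch` supplies the true value of the empty
    -- product.
    poch-self : ∀ b → poch b b ≈ 1#
    poch-self zero    = refl
    poch-self (suc b) with suc b ℕ.≤? b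
    ... | yes b<b = ⊥-elim (ℕₚ.<-irrefl ≡.refl b<b)
    ... | no  _   = refl

    qPoch-* : ∀ {b s} → b ℕ.≤ s → qPoch R r b * poch b s ≈ qPoch R r s
    qPoch-* {b} {s} b≤s with ℕₚ.m≤n⇒m<n∨m≡n b≤s
    ... | inj₂ ≡.refl = trans (*-congˡ (poch-self b)) (*-identityʳ _)
    qPoch-* {b} {suc s} b≤s | inj₁ (s≤s b≤s′) =
      trans (*-congˡ (poch-suc b≤s′)) (trans (sym (*-assoc _ _ _)) (*-congʳ (qPoch-* b≤s′)))

    -- Unrolls α s = r^s B_s t^(s-·) + (1-r^s) append s (α (s-1)).
    total-α : ∀ s j → total (suc s) j (α s) ≈ ∑< (suc s) (λ l → qbin (suc s ℕ.+ j) l * (r ^ l * B l * poch l s))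
    total-α zero j = begin
      total 1 j (α 0)
        ≈⟨ total-cong 1 j (λ v _ → sym (reflexive (≡.cong (t ^_) (ℕₚ.0∸n≡0 v)))) ⟩
      total 1 j (λ v → t ^ (0 ∸ v))
        ≈⟨ total-powers 0 j ⟩
      1#
        ≈⟨ solve 0 (con 1 := con 1 :* (con 1 :* con 1 :* con 1) :+ con 0) refl ⟩
      1# * (1# * 1# * 1#) + 0# ∎
    total-α (suc s) j = begin
      total (suc (suc s)) j (α (suc s))
        ≈⟨ total-cong (suc (suc s)) j (λ v _ → solve 5 (λ p a b c d → p :* (a :* b :+ c :* d) := a :* b :* p :+ c :* (p :* d)) refl (t ^ (suc s ∸ v)) ρ (B (suc s)) (1- ρ) (∑< v (α s))) ⟩
      total (suc (suc s)) j (λ v → ρ * B (suc s) * t ^ (suc s ∸ v) + 1- ρ * append (suc s) (α s) v)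
        ≈⟨ total-linear (suc (suc s)) j (ρ * B (suc s)) (1- ρ) (λ v → t ^ (suc s ∸ v)) (append (suc s) (α s)) ⟩
      ρ * B (suc s) * total (suc (suc s)) j (λ v → t ^ (suc s ∸ v)) + 1- ρ * total (suc s) (suc j) (α s)
        ≈⟨ +-cong (*-congˡ (total-powers (suc s) j)) (*-congˡ IH) ⟩
      ρ * B (suc s) * qbin N (suc s) + 1- ρ * ∑< (suc s) (λ l → qbin N l * (r ^ l * B l * poch l s))
        ≈⟨ +-cong (trans (*-comm _ _) (*-congˡ (trans (sym (*-identityʳ _)) (*-congˡ (sym (poch-self (suc s)))))))
                  (sym (∑<-* (suc s) (1- ρ) (λ l → qbin N l * (r ^ l * B l * poch l s)))) ⟩
      F (suc s) + ∑< (suc s) (λ l → 1- ρ * (qbin N l * (r ^ l * B l * poch l s)))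
        ≈⟨ +-comm _ _ ⟩
      ∑< (suc s) (λ l → 1- ρ * (qbin N l * (r ^ l * B l * poch l s))) + F (suc s)
        ≈⟨ +-congʳ (∑<-cong (suc s) {λ l → 1- ρ * (qbin N l * (r ^ l * B l * poch l s))} {F} λ { l (s≤s l≤s) → trans
             (solve 5 (λ w q a b p → w :* (q :* (a :* b :* p)) := q :* (a :* b :* (p :* w))) refl (1- ρ) (qbin N l) (r ^ l) (B l) (poch l s))
             (*-congˡ (*-congˡ (sym (poch-suc l≤s)))) }) ⟩
      ∑< (suc s) F + F (suc s)
        ≈⟨ ∑<-last (suc s) F ⟨
      ∑< (suc (suc s)) F ∎
      where
      ρ = r ^ suc s
      N = suc (suc s) ℕ.+ j
      F : ℕ → Carrier
      F l = qbin N l * (r ^ l * B l * poch l (suc s))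
      IH : total (suc s) (suc j) (α s) ≈ ∑< (suc s) (λ l → qbin N l * (r ^ l * B l * poch l s))
      IH = ≡.subst (λ z → total (suc s) (suc j) (α s) ≈ ∑< (suc s) (λ l → qbin z l * (r ^ l * B l * poch l s)))
             (≡.cong suc (ℕₚ.+-suc s j)) (total-α s (suc j))

    B-rec : ∀ n → B (suc n) ≈ ∑< (suc n) (λ l → qbin (suc n) l * (r ^ l * B l * poch l n))
    B-rec n = ≡.subst (λ z → B (suc n) ≈ ∑< (suc n) (λ l → qbin z l * (r ^ l * B l * poch l n)))
                (ℕₚ.+-identityʳ (suc n)) (total-α n 0)

    -- The recurrence closed up by its top term: replacing `poch b (i - 1)` by `poch b i` scales the
    -- lower terms to `1- ρ * B i`, and the top term adds `ρ * B i`. It evaluates the sum over the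
    -- low digit.
    qsum-B : ∀ i → qsum i (λ b → r ^ b * B b * poch b i) ≈ B i
    qsum-B zero    = solve 0 (con 1 :* (con 1 :* con 1 :* con 1) :+ con 0 := con 1) refl
    qsum-B (suc i) = begin
      ∑< (suc (suc i)) F
        ≈⟨ ∑<-last (suc i) F ⟩
      ∑< (suc i) F + F (suc i)
        ≈⟨ +-cong (∑<-cong (suc i) {F} {λ l → 1- ρ * G l} λ { l (s≤s l≤i) → trans (*-congˡ (*-congˡ (poch-suc l≤i)))
             (solve 5 (λ w q a b p → q :* (a :* b :* (p :* w)) := w :* (q :* (a :* b :* p))) refl (1- ρ) (qbin (suc i) l) (r ^ l) (B l) (poch l i)) })
           (trans (*-cong (qbin-self (suc i)) (trans (*-congˡ (poch-self (suc i))) (*-identityʳ _))) (*-identityˡ _)) ⟩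
      ∑< (suc i) (λ l → 1- ρ * G l) + ρ * B (suc i)
        ≈⟨ +-congʳ (trans (∑<-* (suc i) (1- ρ) G) (*-congˡ (sym (B-rec i)))) ⟩
      1- ρ * B (suc i) + ρ * B (suc i)
        ≈⟨ trans (+-comm _ _) (sym (distribʳ _ _ _)) ⟩
      (ρ + 1- ρ) * B (suc i)
        ≈⟨ trans (*-congʳ (x+[1-x]≈1 ρ)) (*-identityˡ _) ⟩
      B (suc i) ∎
      where
      ρ = r ^ suc i
      F G : ℕ → Carrier
      F l = qbin (suc i) l * (r ^ l * B l * poch l (suc i))
      G l = qbin (suc i) l * (r ^ l * B l * poch l i)

    -- The induction at a root of unity

    module RootOfUnity (dom : IsIntegralDomain R) (m : ℕ) (prim : IsPrimitiveRoot R (suc m) t) where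
      open Lucas dom m prim

      private
        M = suc m
        x = r ^ M
        y = 1- x
        Q = qPoch R r

      -- The decomposition is quantified inside because the induction step calls the claim at
      -- `M * a + b` for varying digits.
      Claim : ℕ → Set ℓ
      Claim n = ∀ k i → n ≡ M ℕ.* k ℕ.+ i → B n * (Q i * y ^ k) ≈ B i * Q n

      r^[Ma+b] : ∀ a b → r ^ (M ℕ.* a ℕ.+ b) ≈ x ^ a * r ^ b
      r^[Ma+b] a b = trans (^-+ r (M ℕ.* a) b) (*-congʳ (^-* r M a))

      top-digits : ∀ {a e b i} → b ℕ.≤ i → M ℕ.* (a ℕ.+ e) ℕ.+ i ℕ.≤ M ℕ.* a ℕ.+ b → e ≡ 0 × b ≡ i
      top-digits {a} {zero} {b} {i} b≤i le rewrite ℕₚ.+-identityʳ a =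
        ≡.refl , ℕₚ.≤-antisym b≤i (ℕₚ.+-cancelˡ-≤ (M ℕ.* a) i b le)
      top-digits {a} {suc e} {b} {i} b≤i le = ⊥-elim (ℕₚ.<⇒≱
        (ℕₚ.+-mono-<-≤ (ℕₚ.*-monoʳ-< M (ℕₚ.m<m+n a z<s)) b≤i) le)

      step : ∀ n → (∀ {j} → j ℕ.< suc n → Claim j) → Claim (suc n)
      step n IH k i n≡ = trans (*-comm _ _) (+-cancelʳ (ρ * (B i * Q n)) _ _ (begin
        K * B (suc n) + ρ * (B i * Q n)
          ≈⟨ +-cong bottom (trans (*-cong (qbin-self (suc n)) top) (*-identityˡ _)) ⟨
        ∑< (suc n) (λ j → qbin (suc n) j * g j) + qbin (suc n) (suc n) * g (suc n)
          ≈⟨ ∑<-last (suc n) (λ j → qbin (suc n) j * g j) ⟨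
        qsum (suc n) g
          ≡⟨ ≡.cong (λ N → qsum N g) n≡ ⟩
        qsum (M ℕ.* k ℕ.+ i) g
          ≈⟨ qsum-geometric (x+[1-x]≈1 x) k i (Q n) h g digits ⟩
        Q n * qsum i h
          ≈⟨ *-congˡ (qsum-B i) ⟩
        Q n * B i
          ≈⟨ trans (*-congʳ (x+[1-x]≈1 ρ)) (*-identityˡ _) ⟨
        (ρ + 1- ρ) * (Q n * B i)
          ≈⟨ solve 4 (λ p w q b → (p :+ w) :* (q :* b) := b :* (q :* w) :+ p :* (b :* q)) refl ρ (1- ρ) (Q n) (B i) ⟩
        B i * Q (suc n) + ρ * (B i * Q n) ∎))
        where
        open import Algebra.Properties.Group +-group using () renaming (∙-cancelʳ to +-cancelʳ)
        K = Q i * y ^ k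
        ρ = r ^ suc n
        h : ℕ → Carrier
        h b = r ^ b * B b * poch b i
        -- Below `suc n` these are the terms of the recurrence times `K`. At `suc n` the default is
        -- the value predicted for the missing term, free of `B (suc n)`.
        g : ℕ → Carrier
        g j with j ℕ.<? suc n
        ... | yes _ = K * (r ^ j * B j * poch j n)
        ... | no  _ = ρ * (B i * Q n)
        top : g (suc n) ≈ ρ * (B i * Q n)
        top with suc n ℕ.<? suc n
        ... | yes n<n = ⊥-elim (ℕₚ.<-irrefl ≡.refl n<n)
        ... | no  _   = refl
        below : ∀ {j} → j ℕ.< suc n → g j ≈ K * (r ^ j * B j * poch j n)
        below {j} j<n with j ℕ.<? suc n
        ... | yes _   = refl
        ... | no  j≮n = ⊥-elim (j≮n j<n)
        bottom : ∑< (suc n) (λ j → qbin (suc n) j * g j) ≈ K * B (suc n)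
        bottom = begin
          ∑< (suc n) (λ j → qbin (suc n) j * g j)
            ≈⟨ ∑<-cong (suc n) {λ j → qbin (suc n) j * g j} {λ j → K * (qbin (suc n) j * (r ^ j * B j * poch j n))} (λ j j<n → trans (*-congˡ (below j<n))
                 (solve 3 (λ q k z → q :* (k :* z) := k :* (q :* z)) refl (qbin (suc n) j) K (r ^ j * B j * poch j n))) ⟩
          ∑< (suc n) (λ j → K * (qbin (suc n) j * (r ^ j * B j * poch j n)))
            ≈⟨ ∑<-* (suc n) K (λ j → qbin (suc n) j * (r ^ j * B j * poch j n)) ⟩
          K * ∑< (suc n) (λ j → qbin (suc n) j * (r ^ j * B j * poch j n))
            ≈⟨ *-congˡ (B-rec n) ⟨
          K * B (suc n) ∎
        digits : ∀ a e b → a ℕ.+ e ≡ k → b ℕ.≤ i → g (M ℕ.* a ℕ.+ b) ≈ Q n * (x ^ a * y ^ e * h b)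
        digits a e b ≡.refl b≤i with M ℕ.* a ℕ.+ b ℕ.<? suc n
        ... | yes j<n = begin
          -- Splitting `Q i` at `b` and `y ^ (a + e)` at `a` exposes `B j * (Q b * y ^ a)`, the left
          -- side of the induction hypothesis; the leftover `poch b i` goes into `h b`.
          Q i * y ^ (a ℕ.+ e) * (r ^ j * B j * poch j n)
            ≈⟨ *-cong (*-cong (sym (qPoch-* b≤i)) (^-+ y a e)) (*-congʳ (*-congʳ (r^[Ma+b] a b))) ⟩
          Q b * poch b i * (y ^ a * y ^ e) * (x ^ a * r ^ b * B j * poch j n)
            ≈⟨ solve 8 (λ qb pb ya ye xa rb bj pj → qb :* pb :* (ya :* ye) :* (xa :* rb :* bj :* pj) := (bj :* (qb :* ya)) :* (pb :* ye :* xa :* rb :* pj)) refl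
                 (Q b) (poch b i) (y ^ a) (y ^ e) (x ^ a) (r ^ b) (B j) (poch j n) ⟩
          B j * (Q b * y ^ a) * (poch b i * y ^ e * x ^ a * r ^ b * poch j n)
            ≈⟨ *-congʳ (IH j<n a b ≡.refl) ⟩
          B b * Q j * (poch b i * y ^ e * x ^ a * r ^ b * poch j n)
            ≈⟨ solve 7 (λ bb qj pb ye xa rb pj → bb :* qj :* (pb :* ye :* xa :* rb :* pj) := qj :* pj :* (xa :* ye :* (rb :* bb :* pb))) refl
                 (B b) (Q j) (poch b i) (y ^ e) (x ^ a) (r ^ b) (poch j n) ⟩
          Q j * poch j n * (x ^ a * y ^ e * h b)
            ≈⟨ *-congʳ (qPoch-* (ℕₚ.≤-pred j<n)) ⟩
          Q n * (x ^ a * y ^ e * h b) ∎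
          where j = M ℕ.* a ℕ.+ b
        ... | no j≮n with top-digits {a} {e} b≤i (≡.subst (ℕ._≤ M ℕ.* a ℕ.+ b) n≡ (ℕₚ.≮⇒≥ j≮n))
        -- Only the top digits reach `suc n`; there `y ^ e` and `poch b i` are both 1, which matches
        -- the predicted value.
        ... | ≡.refl , ≡.refl = begin
          ρ * (B i * Q n)
            ≈⟨ *-congʳ (trans (reflexive (≡.cong (r ^_) (≡.trans n≡ (≡.cong (λ z → M ℕ.* z ℕ.+ i) (ℕₚ.+-identityʳ a))))) (r^[Ma+b] a i)) ⟩
          x ^ a * r ^ i * (B i * Q n)
            ≈⟨ solve 4 (λ xa ri bi q → xa :* ri :* (bi :* q) := q :* (xa :* con 1 :* (ri :* bi :* con 1))) refl (x ^ a) (r ^ i) (B i) (Q n) ⟩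
          Q n * (x ^ a * 1# * (r ^ i * B i * 1#))
            ≈⟨ *-congˡ (*-congˡ (*-congˡ (poch-self i))) ⟨
          Q n * (x ^ a * 1# * h i) ∎

      B-theorem : ∀ n → Claim n
      B-theorem = <-rec Claim go
        where
        go : ∀ n → (∀ {j} → j ℕ.< n → Claim j) → Claim n
        go (suc n) IH = step n IH
        go zero    IH zero    i eq rewrite ℕₚ.*-zeroʳ m with eq
        ... | ≡.refl = *-congˡ (*-identityʳ _)
        go zero    IH (suc k) i ()

-- From the enumeration of permutations to codes

module Enumeration {c ℓ : Level} (R : CommutativeRing c ℓ) where
  open CommutativeRing R hiding (zero)
  open Ring R
  open import Algebra.Properties.Semiring.Sum semiring
  open import Algebra.Solver.Ring.NaturalCoefficients.Default commutativeSemiring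
    using (solve; _:=_; _:+_; _:*_; con)
  open import Relation.Binary.Reasoning.Setoid setoid

  sumList : {X : Set} → List X → (X → Carrier) → Carrier
  sumList xs F = List.foldr (λ x s → F x + s) 0# xs

  sumList-++ : {X : Set} (xs ys : List X) (F : X → Carrier) → sumList (xs ++ ys) F ≈ sumList xs F + sumList ys F
  sumList-++ []       ys F = sym (+-identityˡ _)
  sumList-++ (x ∷ xs) ys F = trans (+-congˡ (sumList-++ xs ys F)) (sym (+-assoc _ _ _))

  sumList-map : {X Y : Set} (h : X → Y) (xs : List X) (F : Y → Carrier) → sumList (List.map h xs) F ≈ sumList xs (F ∘ h)
  sumList-map h []       F = refl
  sumList-map h (x ∷ xs) F = +-congˡ (sumList-map h xs F)

  sumList-concatMap : {X Y : Set} (h : X → List Y) (g : Fin n → X) (F : Y → Carrier) →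
    sumList (concatMap h (tabulate g)) F ≈ sum (λ i → sumList (h (g i)) F)
  sumList-concatMap {n = zero}  h g F = refl
  sumList-concatMap {n = suc n} h g F = trans
    (sumList-++ (h (g Fin.zero)) (concatMap h (tabulate (g ∘ Fin.suc))) F)
    (+-congˡ (sumList-concatMap h (g ∘ Fin.suc) F))

  sumList-filter : {X : Set} (p : X → Bool) (xs : List X) (F : X → Carrier) →
    sumList (filter (λ x → T? (p x)) xs) F ≈ sumList xs (λ x → if p x then F x else 0#)
  sumList-filter p []       F = refl
  sumList-filter p (x ∷ xs) F with p x
  ... | true  = +-congˡ (sumList-filter p xs F)
  ... | false = trans (sumList-filter p xs F) (sym (+-identityˡ _))

  ∑F : ∀ n k → ((Fin n → Fin k) → Carrier) → Carrier
  ∑F zero    k F = F (λ ())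
  ∑F (suc n) k F = sum λ a → ∑F n k (F ∘ consF a)

  sumList-allFuns : ∀ n k F → sumList (allFuns n k) F ≈ ∑F n k F
  sumList-allFuns zero    k F = +-identityʳ _
  sumList-allFuns (suc n) k F = trans
    (sumList-concatMap (λ a → List.map (consF a) (allFuns n k)) (λ a → a) F)
    (sum-cong-≋ λ a → trans (sumList-map (consF a) (allFuns n k) F) (sumList-allFuns n k (F ∘ consF a)))

  -- Re-indexing produces words that agree only pointwise, so without function extensionality each
  -- summand must respect `_≗_`.
  Extensional : ∀ {n k} → ((Fin n → Fin k) → Carrier) → Set ℓ
  Extensional F = ∀ {f g} → f ≗ g → F f ≈ F g

  consF-cong : ∀ {n k} (a : Fin k) {f g : Fin n → Fin k} → f ≗ g → consF a f ≗ consF a g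
  consF-cong a eq Fin.zero    = ≡.refl
  consF-cong a eq (Fin.suc i) = eq i

  ∑F-cong : ∀ n k {F G} → (∀ f → F f ≈ G f) → ∑F n k F ≈ ∑F n k G
  ∑F-cong zero    k eq = eq _
  ∑F-cong (suc n) k eq = sum-cong-≋ λ a → ∑F-cong n k (eq ∘ consF a)

  ∑F-zero : ∀ n k → ∑F n k (λ _ → 0#) ≈ 0#
  ∑F-zero zero    k = refl
  ∑F-zero (suc n) k = trans (sum-cong-≋ {k} λ _ → ∑F-zero n k) (sum-replicate-zero k)

  ∑F-snoc : ∀ n k {F} → Extensional F → ∑F (suc n) k F ≈ sum (λ a → ∑F n k (λ g → F (snoc g a)))
  ∑F-snoc zero    k ext = sum-cong-≋ {k} λ a → ext {consF a λ ()} {snoc (λ ()) a} λ { Fin.zero → ≡.refl }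
  ∑F-snoc (suc n) k {F} ext = begin
    sum (λ b → ∑F (suc n) k (F ∘ consF b))
      ≈⟨ sum-cong-≋ (λ b → ∑F-snoc n k (λ eq → ext (consF-cong b eq))) ⟩
    sum (λ b → sum (λ a → ∑F n k (λ g → F (consF b (snoc g a)))))
      ≈⟨ ∑-comm (λ b a → ∑F n k (λ g → F (consF b (snoc g a)))) ⟩
    sum (λ a → sum (λ b → ∑F n k (λ g → F (consF b (snoc g a)))))
      ≈⟨ sum-cong-≋ (λ a → sum-cong-≋ {k} λ b → ∑F-cong n k λ g → ext {consF b (snoc g a)} {snoc (consF b g) a} λ { Fin.zero → ≡.refl ; (Fin.suc i) → ≡.refl }) ⟩
    sum (λ a → sum (λ b → ∑F n k (λ g → F (snoc (consF b g) a)))) ∎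

  -- Letter by letter, the choice `a` contributes zero and the other choices are indexed by
  -- `punchIn a`.
  ∑F-avoids : ∀ n k (a : Fin (suc k)) {F} → Extensional F →
    ∑F n (suc k) (λ g → if avoids a g then F g else 0#) ≈ ∑F n k (λ σ → F (punchIn a ∘ σ))
  ∑F-avoids zero    k a ext = ext λ ()
  ∑F-avoids (suc n) k a {F} ext = begin
    sum H
      ≈⟨ sum-remove {i = a} H ⟩
    H a + sum (H ∘ punchIn a)
      ≈⟨ +-cong H-a (sum-cong-≋ H-punchIn) ⟩
    0# + sum (λ b → ∑F n k (λ σ → F (punchIn a ∘ consF b σ)))
      ≈⟨ +-identityˡ _ ⟩
    sum (λ b → ∑F n k (λ σ → F (punchIn a ∘ consF b σ))) ∎
    where
    H : Fin (suc k) → Carrier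
    H b = ∑F n (suc k) (λ g → if not ⌊ b ≟ a ⌋ ∧ avoids a g then F (consF b g) else 0#)
    H-a : H a ≈ 0#
    H-a with a ≟ a
    ... | yes _  = ∑F-zero n (suc k)
    ... | no a≢a = ⊥-elim (a≢a ≡.refl)
    H-punchIn : ∀ b → H (punchIn a b) ≈ ∑F n k (λ σ → F (punchIn a ∘ consF b σ))
    H-punchIn b with punchIn a b ≟ a
    ... | yes eq = ⊥-elim (punchInᵢ≢i a b eq)
    ... | no _   = trans (∑F-avoids n k a (λ eq → ext (consF-cong (punchIn a b) eq)))
                     (∑F-cong n k λ σ → ext λ { Fin.zero → ≡.refl ; (Fin.suc i) → ≡.refl })

  ∑C : ∀ n → (Code n → Carrier) → Carrier
  ∑C zero    G = G []
  ∑C (suc n) G = sum λ a → ∑C n (λ c → G (c ▹ a))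

  ∑C-cong : ∀ n {F G} → (∀ c → F c ≈ G c) → ∑C n F ≈ ∑C n G
  ∑C-cong zero    eq = eq []
  ∑C-cong (suc n) eq = sum-cong-≋ λ a → ∑C-cong n λ c → eq (c ▹ a)

  ∑C-* : ∀ n x G → ∑C n (λ c → x * G c) ≈ x * ∑C n G
  ∑C-* zero    x G = refl
  ∑C-* (suc n) x G = trans (sum-cong-≋ λ a → ∑C-* n x (λ c → G (c ▹ a)))
                           (sym (*-distribˡ-sum x (λ a → ∑C n (λ c → G (c ▹ a)))))

  if-∧ : ∀ p q {x} → (if p ∧ q then x else 0#) ≈ (if p then (if q then x else 0#) else 0#)
  if-∧ true  q = refl
  if-∧ false q = refl

  if-cong : ∀ {p q x y} → p ≡ q → x ≈ y → (if p then x else 0#) ≈ (if q then y else 0#)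
  if-cong {true}  ≡.refl eq = eq
  if-cong {false} ≡.refl eq = refl

  -- Fix the last letter `a`: the earlier letters avoid `a`, and renumbered they form an injective
  -- word on `n` values. This is the recursive clause of `decode`.
  ∑F-injective : ∀ n {G} → Extensional G → ∑F n n (λ π → if injective π then G π else 0#) ≈ ∑C n (G ∘ decode)
  ∑F-injective zero    ext = ext λ ()
  ∑F-injective (suc n) {G} ext = begin
    ∑F (suc n) (suc n) (λ π → if injective π then G π else 0#)
      ≈⟨ ∑F-snoc n (suc n) (λ eq → if-cong (injective-cong eq) (ext eq)) ⟩
    sum (λ a → ∑F n (suc n) (λ g → if injective (snoc g a) then G (snoc g a) else 0#))
      ≈⟨ sum-cong-≋ (λ a → ∑F-cong n (suc n) λ g → trans (if-cong {x = G (snoc g a)} (injective-snoc g a) refl) (if-∧ (avoids a g) (injective g))) ⟩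
    sum (λ a → ∑F n (suc n) (λ g → if avoids a g then (if injective g then G (snoc g a) else 0#) else 0#))
      ≈⟨ sum-cong-≋ (λ a → ∑F-avoids n n a (λ eq → if-cong (injective-cong eq) (ext (snoc-cong a eq)))) ⟩
    sum (λ a → ∑F n n (λ σ → if injective (punchIn a ∘ σ) then G (snoc (punchIn a ∘ σ) a) else 0#))
      ≈⟨ sum-cong-≋ (λ a → ∑F-cong n n λ σ → if-cong {x = G (snoc (punchIn a ∘ σ) a)} (injective-punchIn a σ) refl) ⟩
    sum (λ a → ∑F n n (λ σ → if injective σ then G (snoc (punchIn a ∘ σ) a) else 0#))
      ≈⟨ sum-cong-≋ (λ a → ∑F-injective n (λ eq → ext (snoc-cong a (≡.cong (punchIn a) ∘ eq)))) ⟩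
    sum (λ a → ∑C n (λ c → G (decode (c ▹ a)))) ∎

  -- Source of the factors 1-rˢ: the weight 1 of an ascent is split as `ρ + 1- ρ`, so `ρ` covers
  -- every `u` and `1- ρ` only those below `v`.
  ∑<-threshold : ∀ ρ N v f → v ℕ.≤ N →
    ∑< N (λ u → (if u <ᵇ v then 1# else ρ) * f u) ≈ ρ * ∑< N f + 1- ρ * ∑< v f
  ∑<-threshold ρ N zero f _ = begin
    ∑< N (λ u → ρ * f u)       ≈⟨ ∑<-* N ρ f ⟩
    ρ * ∑< N f                 ≈⟨ +-identityʳ _ ⟨
    ρ * ∑< N f + 0#            ≈⟨ +-congˡ (zeroʳ _) ⟨
    ρ * ∑< N f + 1- ρ * 0#     ∎
  ∑<-threshold ρ (suc N) (suc v) f (s≤s v≤N) = begin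
    1# * f 0 + ∑< N (λ u → (if u <ᵇ v then 1# else ρ) * f (suc u))
      ≈⟨ +-cong (*-congʳ (sym (x+[1-x]≈1 ρ))) (∑<-threshold ρ N v (f ∘ suc) v≤N) ⟩
    (ρ + 1- ρ) * f 0 + (ρ * ∑< N (f ∘ suc) + 1- ρ * ∑< v (f ∘ suc))
      ≈⟨ solve 5 (λ p w x a b → (p :+ w) :* x :+ (p :* a :+ w :* b) := p :* (x :+ a) :+ w :* (x :+ b)) refl ρ (1- ρ) (f 0) (∑< N (f ∘ suc)) (∑< v (f ∘ suc)) ⟩
    ρ * (f 0 + ∑< N (f ∘ suc)) + 1- ρ * (f 0 + ∑< v (f ∘ suc)) ∎

  -- Weights of codes

  module _ (t r : Carrier) where
    open Transfer t r

    weight : ∀ {n k} → (Fin n → Fin k) → Carrier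
    weight g = t ^ inversions g * r ^ major g

    weight-decode : ∀ {n} (c : Code n) u (a : Fin (suc (suc n))) →
      weight (decode (c ▹ u ▹ a)) ≈
      t ^ (suc n ∸ toℕ a) * ((if toℕ u <ᵇ toℕ a then 1# else r ^ suc n) * weight (decode (c ▹ u)))
    weight-decode {n} c u a
      rewrite inversions-decode (c ▹ u) a | major-decode c u a = begin
      t ^ (I ℕ.+ e) * r ^ (J ℕ.+ (if b then 0 else suc n))
        ≈⟨ *-cong (^-+ t I e) (trans (^-+ r J (if b then 0 else suc n)) (*-congˡ (r^if b))) ⟩
      t ^ I * t ^ e * (r ^ J * (if b then 1# else r ^ suc n))
        ≈⟨ solve 4 (λ i e j d → i :* e :* (j :* d) := e :* (d :* (i :* j))) refl (t ^ I) (t ^ e) (r ^ J) (if b then 1# else r ^ suc n) ⟩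
      t ^ e * ((if b then 1# else r ^ suc n) * (t ^ I * r ^ J)) ∎
      where
      I = inversions (decode (c ▹ u))
      J = major (decode (c ▹ u))
      e = suc n ∸ toℕ a
      b = toℕ u <ᵇ toℕ a
      r^if : ∀ b → r ^ (if b then 0 else suc n) ≈ (if b then 1# else r ^ suc n)
      r^if true  = refl
      r^if false = refl

    -- Only the preceding rank `u` enters the new factor, so the sum over older ranks is the
    -- induction hypothesis at `u`, and `∑<-threshold` gives the recursion of `α`.
    ∑C-weight : ∀ n (a : Fin (suc n)) → ∑C n (λ c → weight (decode (c ▹ a))) ≈ α n (toℕ a)
    ∑C-weight zero Fin.zero = *-identityˡ 1#
    ∑C-weight (suc n) a = begin
      sum (λ u → ∑C n (λ c → weight (decode (c ▹ u ▹ a))))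
        ≈⟨ sum-cong-≋ (λ u → trans
             (∑C-cong n λ c → trans (weight-decode c u a) (sym (*-assoc _ _ _)))
             (trans (∑C-* n (t ^ e * δ (toℕ u)) (λ c → weight (decode (c ▹ u))))
               (trans (*-congˡ (∑C-weight n u)) (*-assoc _ _ _)))) ⟩
      ∑< (suc n) (λ u → t ^ e * (δ u * α n u))
        ≈⟨ ∑<-* (suc n) (t ^ e) (λ u → δ u * α n u) ⟩
      t ^ e * ∑< (suc n) (λ u → δ u * α n u)
        ≈⟨ *-congˡ (∑<-threshold (r ^ suc n) (suc n) (toℕ a) (α n) (ℕₚ.≤-pred (toℕ<n a))) ⟩
      α (suc n) (toℕ a) ∎
      where
      e = suc n ∸ toℕ a
      δ : ℕ → Carrier
      δ u = if u <ᵇ toℕ a then 1# else r ^ suc n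

    A≈B : ∀ n → A R n t r ≈ B n
    A≈B n = begin
      A R n t r
        ≈⟨ sumList-filter isInjectiveB (allFuns n n) (λ π → t ^ inv π * r ^ maj π) ⟩
      sumList (allFuns n n) (λ π → if isInjectiveB π then t ^ inv π * r ^ maj π else 0#)
        ≈⟨ sumList-allFuns n n _ ⟩
      ∑F n n (λ π → if isInjectiveB π then t ^ inv π * r ^ maj π else 0#)
        ≈⟨ ∑F-cong n n (λ π → if-cong (isInjectiveB≡injective π)
             (*-cong (reflexive (≡.cong (t ^_) (inv≡inversions π))) (reflexive (≡.cong (r ^_) (maj≡major π))))) ⟩
      ∑F n n (λ π → if injective π then weight π else 0#)
        ≈⟨ ∑F-injective n (λ eq → *-cong (reflexive (≡.cong (t ^_) (inversions-cong eq))) (reflexive (≡.cong (r ^_) (major-cong eq)))) ⟩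
      ∑C n (weight ∘ decode)
        ≈⟨ last-letter n ⟩
      B n ∎
      where
      last-letter : ∀ n → ∑C n (weight ∘ decode) ≈ B n
      last-letter zero    = *-identityˡ 1#
      last-letter (suc n) = sum-cong-≋ (∑C-weight n)

open import Data.Nat using (_+_; _*_; _<_)

theorem4p4 : {c ℓ : Level} (R : CommutativeRing c ℓ) → IsIntegralDomain R →
    (n m k i : ℕ) → 0 < n → 0 < m → i < m → n ≡ m * k + i →
    (ζ : CommutativeRing.Carrier R) → IsPrimitiveRoot R m ζ →
    (r : CommutativeRing.Carrier R) →
    CommutativeRing._≈_ R
    (CommutativeRing._*_ R (A R n ζ r)
    (CommutativeRing._*_ R (qPoch R r i) (pow R (CommutativeRing._-_ R (CommutativeRing.1# R) (pow R r m)) k)))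
    (CommutativeRing._*_ R (A R i ζ r) (qPoch R r n))
theorem4p4 R dom n (suc m) k i _ _ _ n≡mk+i ζ prim r = begin
  A R n ζ r R.* _   ≈⟨ R.*-congʳ (A≈B ζ r n) ⟩
  B n R.* _         ≈⟨ B-theorem n k i n≡mk+i ⟩
  B i R.* _         ≈⟨ R.*-congʳ (A≈B ζ r i) ⟨
  A R i ζ r R.* _   ∎
  where
  module R = CommutativeRing R
  open Enumeration R
  open Ring.Transfer R ζ r
  open RootOfUnity dom m prim
  open import Relation.Binary.Reasoning.Setoid R.setoid
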